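{- Let $\mathcal{B}(z)=\sum_{n\ge 0} |\mathcal{S}_n\cap Av(\mathbf{4123},\mathbf{1324},\mathbf{3124})|\, z^n$ be the generating function for $Av(\mathbf{4123},\mathbf{1324},\mathbf{3124})$. Then $$\mathcal{B}(z) = \frac{(1-3z)(1+\sqrt{1-4z})}{2\sqrt{1-4z}\,(1-3z+z^2)}.$$
   Context: A permutation $\sigma$ contains a pattern $\pi$ if some subsequence of $\sigma$ is order-isomorphic to $\pi$; otherwise $\sigma$ avoids $\pi$. For a set $B$ of patterns, $Av(B)$ is the set of permutations avoiding every element of $B$, and $\mathcal{S}_n$ is the set of permutations of length $n$ (the empty permutation is counted for $n=0$). -}

module Defs where

open import Data.Nat using (ℕ; zero; suc; _∸_)
open import Data.Integer using (ℤ; +_; -[1+_]) renaming (_+_ to _+ℤ_; _*_ to _*ℤ_)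
open import Data.Fin using (Fin; #_) renaming (_<_ to _<ᶠ_)
open import Data.Vec using (Vec; lookup; _∷_; [])
open import Data.List using (List; length) renaming (_∷_ to _∷ˡ_; [] to []ˡ)
open import Data.List.Relation.Unary.All using (All)
open import Data.List.Relation.Unary.Unique.Propositional using (Unique)
open import Data.List.Membership.Propositional using (_∈_)
open import Data.Product using (Σ; _×_; ∃)
open import Function.Bundles using (_⇔_)
open import Relation.Binary.PropositionalEquality using (_≡_)
open import Relation.Nullary using (¬_)

IsPerm : ∀ {n} → Vec (Fin n) n → Set
IsPerm {n} σ = ∀ (i j : Fin n) → lookup σ i ≡ lookup σ j → i ≡ j

Contains : ∀ {n k} → Vec (Fin n) n → Vec (Fin k) k → Set
Contains {n} {k} σ π =
  Σ (Fin k → Fin n) λ f →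
    (∀ i j → i <ᶠ j → f i <ᶠ f j) ×
    (∀ i j → (lookup π i <ᶠ lookup π j) ⇔ (lookup σ (f i) <ᶠ lookup σ (f j)))

Avoids : ∀ {n} → Vec (Fin n) n → List (Vec (Fin 4) 4) → Set
Avoids σ B = All (λ π → ¬ Contains σ π) B

-- 4123, 1324, 3124 in 0-based one-line notation
p4123 p1324 p3124 : Vec (Fin 4) 4
p4123 = # 3 ∷ # 0 ∷ # 1 ∷ # 2 ∷ []
p1324 = # 0 ∷ # 2 ∷ # 1 ∷ # 3 ∷ []
p3124 = # 2 ∷ # 0 ∷ # 1 ∷ # 3 ∷ []

basis : List (Vec (Fin 4) 4)
basis = p4123 ∷ˡ p1324 ∷ˡ p3124 ∷ˡ []ˡ

HasCard : {A : Set} → (A → Set) → ℕ → Set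
HasCard {A} P c =
  Σ (List A) λ L → Unique L × (length L ≡ c) × (∀ x → (x ∈ L) ⇔ P x)

-- Formal power series over ℤ, as coefficient sequences.

PS : Set
PS = ℕ → ℤ

_≈ₚ_ : PS → PS → Set
f ≈ₚ g = ∀ n → f n ≡ g n

Σ≤ : (ℕ → ℤ) → ℕ → ℤ
Σ≤ h zero = h zero
Σ≤ h (suc n) = Σ≤ h n +ℤ h (suc n)

_⊛_ : PS → PS → PS
(f ⊛ g) n = Σ≤ (λ i → f i *ℤ g (n ∸ i)) n

_⊕_ : PS → PS → PS
(f ⊕ g) n = f n +ℤ g n

poly : List ℤ → PS
poly []ˡ n = + 0
poly (a ∷ˡ as) zero = a
poly (a ∷ˡ as) (suc n) = poly as n

{-# OPTIONS --safe #-}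

-- Permutations are grown by appending a last value. A site (a possible new last value) is active if appending there
-- keeps the permutation in the class: it must not lie above the 2 of a 312 nor above the 3 of a 132, so the active
-- sites form an initial segment. Say that v splits the permutation if all values below v precede all values above.
-- Appending at an inner site v creates a 312 that deactivates everything above v, unless v splits; then it only
-- creates a 132, and one more site stays active. So the active sites and the splitting sites determine the subtree
-- of descendants, and both are described by the three families D, E, U of labels.
--
-- The generating functions of the labels satisfy linear recurrences: that of D k is the k-th power of the Catalan
-- series C, those of E l j and U l m are C ^ l times those of E 0 j and U 0 m, and what remains is linear in
-- Γ = Σ z ^ j E 0 j, Π = Σ z ^ j (E 0 0 + … + E 0 j) and X = U 0 0. Finally √(1 − 4z) = 1 − 2zC.
module Submission where

open import Defs
open import Data.Nat using (ℕ)
open import Data.Integer using (ℤ; +_; -[1+_])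
open import Data.Fin using (Fin)
open import Data.Vec using (Vec)
open import Data.List using (List; _∷_; [])
open import Data.Product using (_×_)
open import Relation.Binary.PropositionalEquality using (_≡_)

-- The parameter l costs nothing, for the following reason. The sites 1 ... l of an `E l j` or a
-- `U l m` have, up to order, the children of a `D l`, so l enters the equations only through gf (D
-- l) and through the labels of the remaining children. All of these are compatible with the
-- recurrence F (l + 1) = F l + z F (l + 2) of the powers of C. Induction on labels cannot show that
-- the solutions obey it, because labels grow along the tree. Instead the deviations from the
-- recurrence solve a homogeneous system whose right-hand sides all carry a factor z, so their
-- coefficients vanish one after another. The parameter m disappears by unrolling the chain U 0 0, U
-- 0 1, ... of appended maxima. This gives the m-th equation the weight z ^ m, which is why the
-- families `E 0 j` are needed only through sums with the weights z ^ j.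

-- The commutative ring of formal power series over ℤ.

module PowerSeries where

  open import Algebra.Bundles using (CommutativeRing)
  import Algebra.Solver.Ring
  open import Algebra.Solver.Ring.AlmostCommutativeRing
    using (AlmostCommutativeRing; fromCommutativeRing; _-Raw-AlmostCommutative⟶_)
  open import Algebra.Structures using (IsCommutativeRing)
  open import Data.Integer using (_+_; _*_; -_; +-*-rawRing)
  open import Data.Integer.Properties
    using (_≟_; +-comm; +-assoc; +-identityˡ; +-identityʳ; +-inverseˡ; +-inverseʳ; *-comm; *-assoc;
           *-identityˡ; *-zeroˡ; *-zeroʳ; *-distribʳ-+; i*j≡0⇒i≡0∨j≡0)
  open import Data.Integer.Tactic.RingSolver using (solve-∀)
  import Data.Maybe as Maybe
  open import Data.Nat using (zero; suc)
  open import Data.Product using (_,_)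
  open import Data.Sum using (inj₁; inj₂)
  open import Function using (_∘_)
  open import Level using (0ℓ)
  open import Relation.Binary.PropositionalEquality
    using (_≢_; refl; sym; trans; cong; cong₂; module ≡-Reasoning)
  open import Relation.Nullary using (contradiction)
  open import Relation.Nullary.Decidable using (dec⇒maybe)

  Σ≤-cons : ∀ h n → Σ≤ h (suc n) ≡ h 0 + Σ≤ (h ∘ suc) n
  Σ≤-cons h zero    = refl
  Σ≤-cons h (suc n) = trans (cong (_+ h (suc (suc n))) (Σ≤-cons h n)) (+-assoc (h 0) _ _)

  tail : PS → PS
  tail f n = f (suc n)

  infixr 8 _·_
  _·_ : ℤ → PS → PS
  (c · f) n = c * f n

  ⊛-suc : ∀ f g n → (f ⊛ g) (suc n) ≡ f 0 * g (suc n) + (tail f ⊛ g) n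
  ⊛-suc f g n = Σ≤-cons _ n

  -- Splits off the last term of the convolution where `⊛-suc` splits off the first. The two
  -- together give commutativity by induction, and this one exposes the tail of the right factor for
  -- cancellation.
  ⊛-sucʳ : ∀ f g n → (f ⊛ g) (suc n) ≡ (f ⊛ tail g) n + f (suc n) * g 0
  ⊛-sucʳ f g zero    = refl
  ⊛-sucʳ f g (suc n) = begin
    (f ⊛ g) (suc (suc n))
      ≡⟨ ⊛-suc f g (suc n) ⟩
    f 0 * g (suc (suc n)) + (tail f ⊛ g) (suc n)
      ≡⟨ cong (_+_ (f 0 * g (suc (suc n)))) (⊛-sucʳ (tail f) g n) ⟩
    f 0 * g (suc (suc n)) + ((tail f ⊛ tail g) n + f (suc (suc n)) * g 0)
      ≡⟨ +-assoc (f 0 * g (suc (suc n))) _ _ ⟨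
    f 0 * g (suc (suc n)) + (tail f ⊛ tail g) n + f (suc (suc n)) * g 0
      ≡⟨ cong (_+ f (suc (suc n)) * g 0) (⊛-suc f (tail g) n) ⟨
    (f ⊛ tail g) (suc n) + f (suc (suc n)) * g 0 ∎
    where open ≡-Reasoning

  ⊛-cong : ∀ {f f′ g g′} → f ≈ₚ f′ → g ≈ₚ g′ → (f ⊛ g) ≈ₚ (f′ ⊛ g′)
  ⊛-cong                p q zero    = cong₂ _*_ (p 0) (q 0)
  ⊛-cong {f} {f′} {g} {g′} p q (suc n) = begin
    (f ⊛ g) (suc n)                      ≡⟨ ⊛-suc f g n ⟩
    f 0 * g (suc n) + (tail f ⊛ g) n     ≡⟨ cong₂ _+_ (cong₂ _*_ (p 0) (q (suc n))) (⊛-cong (p ∘ suc) q n) ⟩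
    f′ 0 * g′ (suc n) + (tail f′ ⊛ g′) n ≡⟨ ⊛-suc f′ g′ n ⟨
    (f′ ⊛ g′) (suc n) ∎
    where open ≡-Reasoning

  ⊛-comm : ∀ f g → (f ⊛ g) ≈ₚ (g ⊛ f)
  ⊛-comm f g zero    = *-comm (f 0) (g 0)
  ⊛-comm f g (suc n) = begin
    (f ⊛ g) (suc n)                  ≡⟨ ⊛-suc f g n ⟩
    f 0 * g (suc n) + (tail f ⊛ g) n ≡⟨ cong₂ _+_ (*-comm (f 0) _) (⊛-comm (tail f) g n) ⟩
    g (suc n) * f 0 + (g ⊛ tail f) n ≡⟨ +-comm (g (suc n) * f 0) _ ⟩
    (g ⊛ tail f) n + g (suc n) * f 0 ≡⟨ ⊛-sucʳ g f n ⟨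
    (g ⊛ f) (suc n) ∎
    where open ≡-Reasoning

  ⊛-distribʳ : ∀ h f g → ((f ⊕ g) ⊛ h) ≈ₚ ((f ⊛ h) ⊕ (g ⊛ h))
  ⊛-distribʳ h f g zero    = *-distribʳ-+ (h 0) (f 0) (g 0)
  ⊛-distribʳ h f g (suc n) = begin
    ((f ⊕ g) ⊛ h) (suc n)
      ≡⟨ ⊛-suc (f ⊕ g) h n ⟩
    (f 0 + g 0) * h (suc n) + ((tail f ⊕ tail g) ⊛ h) n
      ≡⟨ cong (_+_ ((f 0 + g 0) * h (suc n))) (⊛-distribʳ h (tail f) (tail g) n) ⟩
    (f 0 + g 0) * h (suc n) + ((tail f ⊛ h) n + (tail g ⊛ h) n)
      ≡⟨ rearrange (f 0) (g 0) (h (suc n)) _ _ ⟩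
    (f 0 * h (suc n) + (tail f ⊛ h) n) + (g 0 * h (suc n) + (tail g ⊛ h) n)
      ≡⟨ cong₂ _+_ (⊛-suc f h n) (⊛-suc g h n) ⟨
    (f ⊛ h) (suc n) + (g ⊛ h) (suc n) ∎
    where
    open ≡-Reasoning
    rearrange : ∀ a b c x y → (a + b) * c + (x + y) ≡ (a * c + x) + (b * c + y)
    rearrange = solve-∀

  ·-⊛ : ∀ c f g → ((c · f) ⊛ g) ≈ₚ (c · (f ⊛ g))
  ·-⊛ c f g zero    = *-assoc c (f 0) (g 0)
  ·-⊛ c f g (suc n) = begin
    ((c · f) ⊛ g) (suc n)                          ≡⟨ ⊛-suc (c · f) g n ⟩
    c * f 0 * g (suc n) + ((c · tail f) ⊛ g) n     ≡⟨ cong (_+_ (c * f 0 * g (suc n))) (·-⊛ c (tail f) g n) ⟩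
    c * f 0 * g (suc n) + c * (tail f ⊛ g) n       ≡⟨ rearrange c (f 0) (g (suc n)) _ ⟩
    c * (f 0 * g (suc n) + (tail f ⊛ g) n)         ≡⟨ cong (c *_) (⊛-suc f g n) ⟨
    c * (f ⊛ g) (suc n) ∎
    where
    open ≡-Reasoning
    rearrange : ∀ c a b x → c * a * b + c * x ≡ c * (a * b + x)
    rearrange = solve-∀

  ⊛-assoc : ∀ f g h → ((f ⊛ g) ⊛ h) ≈ₚ (f ⊛ (g ⊛ h))
  ⊛-assoc f g h zero    = *-assoc (f 0) (g 0) (h 0)
  ⊛-assoc f g h (suc n) = begin
    ((f ⊛ g) ⊛ h) (suc n)
      ≡⟨ ⊛-suc (f ⊛ g) h n ⟩
    f 0 * g 0 * h (suc n) + (tail (f ⊛ g) ⊛ h) n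
      ≡⟨ cong (_+_ (f 0 * g 0 * h (suc n))) (⊛-cong {g = h} (⊛-suc f g) (λ _ → refl) n) ⟩
    f 0 * g 0 * h (suc n) + (((f 0 · tail g) ⊕ (tail f ⊛ g)) ⊛ h) n
      ≡⟨ cong (_+_ (f 0 * g 0 * h (suc n))) (⊛-distribʳ h (f 0 · tail g) (tail f ⊛ g) n) ⟩
    f 0 * g 0 * h (suc n) + (((f 0 · tail g) ⊛ h) n + ((tail f ⊛ g) ⊛ h) n)
      ≡⟨ cong (_+_ (f 0 * g 0 * h (suc n))) (cong₂ _+_ (·-⊛ (f 0) (tail g) h n) (⊛-assoc (tail f) g h n)) ⟩
    f 0 * g 0 * h (suc n) + (f 0 * (tail g ⊛ h) n + (tail f ⊛ (g ⊛ h)) n)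
      ≡⟨ rearrange (f 0) (g 0) (h (suc n)) _ _ ⟩
    f 0 * (g 0 * h (suc n) + (tail g ⊛ h) n) + (tail f ⊛ (g ⊛ h)) n
      ≡⟨ cong (λ x → f 0 * x + (tail f ⊛ (g ⊛ h)) n) (⊛-suc g h n) ⟨
    f 0 * (g ⊛ h) (suc n) + (tail f ⊛ (g ⊛ h)) n
      ≡⟨ ⊛-suc f (g ⊛ h) n ⟨
    (f ⊛ (g ⊛ h)) (suc n) ∎
    where
    open ≡-Reasoning
    rearrange : ∀ a b c x y → a * b * c + (a * x + y) ≡ a * (b * c + x) + y
    rearrange = solve-∀

  const : ℤ → PS
  const a = poly (a ∷ [])

  ⊛-zeroˡ : ∀ f → (poly [] ⊛ f) ≈ₚ poly []
  ⊛-zeroˡ f zero    = *-zeroˡ (f 0)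
  ⊛-zeroˡ f (suc n) = trans (⊛-suc (poly []) f n) (trans (cong₂ _+_ (*-zeroˡ (f (suc n))) (⊛-zeroˡ f n)) refl)

  const-⊛ : ∀ a f → (const a ⊛ f) ≈ₚ (a · f)
  const-⊛ a f zero    = refl
  const-⊛ a f (suc n) = trans (⊛-suc (const a) f n) (trans (cong (_+_ (a * f (suc n))) (⊛-zeroˡ f n)) (+-identityʳ _))

  ⊛-identityˡ : ∀ f → (const (+ 1) ⊛ f) ≈ₚ f
  ⊛-identityˡ f n = trans (const-⊛ (+ 1) f n) (*-identityˡ (f n))

  shift : PS → PS
  shift f zero    = + 0
  shift f (suc n) = f n

  z : PS
  z = poly (+ 0 ∷ + 1 ∷ [])

  z⊛ : ∀ f → (z ⊛ f) ≈ₚ shift f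
  z⊛ f zero    = *-zeroˡ (f 0)
  z⊛ f (suc n) = trans (⊛-suc z f n) (trans (cong₂ _+_ (*-zeroˡ (f (suc n))) (⊛-identityˡ f n)) (+-identityˡ _))

  poly-∷ : ∀ a as → poly (a ∷ as) ≈ₚ (const a ⊕ (z ⊛ poly as))
  poly-∷ a as zero    = sym (+-identityʳ a)
  poly-∷ a as (suc n) = sym (trans (+-identityˡ _) (z⊛ (poly as) (suc n)))

  -- The relation is wrapped, and the operations below are opaque, so that unification can read off the series
  -- involved; both _≈ₚ_ and the operations of Defs unfold to statements about coefficients.
  infix 4 _≋_
  record _≋_ (f g : PS) : Set where
    constructor pointwise
    field coeff : f ≈ₚ g
  open _≋_

  opaque
    infixl 6 _⊞_
    infixl 7 _⊠_
    infix  8 ⊟_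

    _⊞_ _⊠_ : PS → PS → PS
    _⊞_ = _⊕_
    _⊠_ = _⊛_

    ⊟_ : PS → PS
    (⊟ f) n = - f n

    PS-isCommutativeRing : IsCommutativeRing _≋_ _⊞_ _⊠_ ⊟_ (const (+ 0)) (const (+ 1))
    PS-isCommutativeRing = record
      { isRing = record
        { +-isAbelianGroup = record
          { isGroup = record
            { isMonoid = record
              { isSemigroup = record
                { isMagma = record
                  { isEquivalence = record
                    { refl  = pointwise λ n → refl
                    ; sym   = λ p → pointwise λ n → sym (coeff p n)
                    ; trans = λ p q → pointwise λ n → trans (coeff p n) (coeff q n)
                    }
                  ; ∙-cong = λ p q → pointwise λ n → cong₂ _+_ (coeff p n) (coeff q n)
                  }
                ; assoc = λ f g h → pointwise λ n → +-assoc (f n) (g n) (h n)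
                }
              ; identity = (λ f → pointwise (0⊕ f)) , λ f → pointwise λ n → trans (+-comm (f n) _) (0⊕ f n)
              }
            ; inverse = (λ f → pointwise λ n → trans (+-inverseˡ (f n)) (0≡ n))
                      , (λ f → pointwise λ n → trans (+-inverseʳ (f n)) (0≡ n))
            ; ⁻¹-cong = λ p → pointwise λ n → cong -_ (coeff p n)
            }
          ; comm = λ f g → pointwise λ n → +-comm (f n) (g n)
          }
        ; *-cong     = λ p q → pointwise (⊛-cong (coeff p) (coeff q))
        ; *-assoc    = λ f g h → pointwise (⊛-assoc f g h)
        ; *-identity = (λ f → pointwise (⊛-identityˡ f))
                     , λ f → pointwise λ n → trans (⊛-comm f (const (+ 1)) n) (⊛-identityˡ f n)
        ; distrib    = (λ h f g → pointwise λ n → trans (⊛-comm h (f ⊕ g) n)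
                           (trans (⊛-distribʳ h f g n) (cong₂ _+_ (⊛-comm f h n) (⊛-comm g h n))))
                     , λ h f g → pointwise (⊛-distribʳ h f g)
        }
      ; *-comm = λ f g → pointwise (⊛-comm f g)
      }
      where
      0≡ : ∀ n → + 0 ≡ const (+ 0) n
      0≡ zero    = refl
      0≡ (suc n) = refl
      0⊕ : ∀ f → (const (+ 0) ⊕ f) ≈ₚ f
      0⊕ f zero    = +-identityˡ (f 0)
      0⊕ f (suc n) = +-identityˡ (f (suc n))

  PS-commutativeRing : CommutativeRing 0ℓ 0ℓ
  PS-commutativeRing = record { isCommutativeRing = PS-isCommutativeRing }

  module PSR = CommutativeRing PS-commutativeRing

  PS-almostCommutativeRing : AlmostCommutativeRing 0ℓ 0ℓ
  PS-almostCommutativeRing = fromCommutativeRing PS-commutativeRing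

  opaque
    unfolding _⊞_ _⊠_ ⊟_

    const-⊞ : ∀ a b → const (a + b) ≋ const a ⊞ const b
    const-⊞ a b = pointwise λ { zero → refl ; (suc n) → refl }

    const-⊠ : ∀ a b → const (a * b) ≋ const a ⊠ const b
    const-⊠ a b = pointwise λ { zero → refl ; (suc n) → trans (sym (*-zeroʳ a)) (sym (const-⊛ a (const b) (suc n))) }

    const-⊟ : ∀ a → const (- a) ≋ ⊟ const a
    const-⊟ a = pointwise λ { zero → refl ; (suc n) → refl }

  const-homomorphism : +-*-rawRing -Raw-AlmostCommutative⟶ PS-almostCommutativeRing
  const-homomorphism = record
    { ⟦_⟧    = const
    ; +-homo = const-⊞
    ; *-homo = const-⊠
    ; -‿homo = const-⊟
    ; 0-homo = PSR.refl
    ; 1-homo = PSR.refl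
    }

  module PSSolver = Algebra.Solver.Ring +-*-rawRing PS-almostCommutativeRing const-homomorphism
    (λ a b → Maybe.map (λ p → PSR.reflexive (cong const p)) (dec⇒maybe (a ≟ b)))

  opaque
    unfolding _⊠_

    -- ℤ has no zero divisors, so the constant term of f vanishes; then the product of a with
    -- `tail f` vanishes too, and the argument repeats.
    ⊠-cancel-zero : ∀ a f → a 0 ≢ + 0 → a ⊠ f ≋ const (+ 0) → f ≋ const (+ 0)
    ⊠-cancel-zero a f a₀≢0 p = pointwise λ n → trans (vanish f (coeff p) n) (0≡ n)
      where
      0≡ : ∀ n → + 0 ≡ const (+ 0) n
      0≡ zero    = refl
      0≡ (suc n) = refl
      vanish : ∀ f → (a ⊛ f) ≈ₚ const (+ 0) → ∀ n → f n ≡ + 0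
      head-vanish : ∀ f → (a ⊛ f) ≈ₚ const (+ 0) → f 0 ≡ + 0
      head-vanish f p with i*j≡0⇒i≡0∨j≡0 (a 0) (p 0)
      ... | inj₁ a₀≡0 = contradiction a₀≡0 a₀≢0
      ... | inj₂ f₀≡0 = f₀≡0
      vanish f p zero    = head-vanish f p
      vanish f p (suc n) = vanish (tail f) tail-zero n
        where
        open ≡-Reasoning
        tail-zero : (a ⊛ tail f) ≈ₚ const (+ 0)
        tail-zero m = begin
          (a ⊛ tail f) m                   ≡⟨ +-identityʳ _ ⟨
          (a ⊛ tail f) m + + 0             ≡⟨ cong (_+_ ((a ⊛ tail f) m)) (*-zeroʳ (a (suc m))) ⟨
          (a ⊛ tail f) m + a (suc m) * + 0 ≡⟨ cong (λ x → (a ⊛ tail f) m + a (suc m) * x) (head-vanish f p) ⟨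
          (a ⊛ tail f) m + a (suc m) * f 0 ≡⟨ ⊛-sucʳ a f m ⟨
          (a ⊛ f) (suc m)                  ≡⟨ p (suc m) ⟩
          + 0                              ≡⟨ 0≡ m ⟩
          const (+ 0) m                    ∎

  open PSSolver public using (solve; con; _:+_; _:*_; _:^_; _:-_; :-_; _:=_)

  ⊠-cancelˡ : ∀ a f g → a 0 ≢ + 0 → a ⊠ f ≋ a ⊠ g → f ≋ g
  ⊠-cancelˡ a f g a₀≢0 p = begin
    f                ≈⟨ solve 2 (λ f g → f := (f :- g) :+ g) PSR.refl f g ⟩
    (f ⊞ ⊟ g) ⊞ g    ≈⟨ PSR.+-congʳ (⊠-cancel-zero a (f ⊞ ⊟ g) a₀≢0 difference) ⟩
    const (+ 0) ⊞ g  ≈⟨ PSR.+-identityˡ g ⟩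
    g ∎
    where
    open import Relation.Binary.Reasoning.Setoid PSR.setoid
    difference : a ⊠ (f ⊞ ⊟ g) ≋ const (+ 0)
    difference = begin
      a ⊠ (f ⊞ ⊟ g)    ≈⟨ solve 3 (λ a f g → a :* (f :- g) := a :* f :- a :* g) PSR.refl a f g ⟩
      (a ⊠ f) ⊞ (⊟ (a ⊠ g))  ≈⟨ PSR.+-congʳ p ⟩
      (a ⊠ g) ⊞ (⊟ (a ⊠ g))  ≈⟨ PSR.-‿inverseʳ (a ⊠ g) ⟩
      const (+ 0) ∎

-- The generating tree and its labels.

module GeneratingTree where

  open import Data.Nat using (zero; suc; _+_)
  open import Function using (_∘_)

  piece : ∀ {A : Set} → ℕ → (ℕ → A) → (ℕ → A) → ℕ → A
  piece zero    f g v       = g v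
  piece (suc l) f g zero    = f 0
  piece (suc l) f g (suc v) = piece l (f ∘ suc) g v

  -- The labels of the tree, with l, j, k, m as in Invariant below: the active sites of a D k are 0 … k − 1 and
  -- no positive one splits; those of an E l j are 0 … l + j + 2 and l + 1 … l + j + 1 split;
  -- for a U l m every site is active and l + 1 … l + m + 1 split.
  data State : Set where
    root : State
    D    : ℕ → State
    E U  : ℕ → ℕ → State

  -- The number of active sites, as a sum to which the pieces of child correspond.
  arity : State → ℕ
  arity root    = 1
  arity (D k)   = k
  arity (E l j) = suc (l + (suc j + 1))
  arity (U l m) = suc (l + (m + 1))

  D₂ : ℕ → State
  D₂ i = D (2 + i)

  -- Site 0 raises all values: every active site survives, one is gained, and no old positive split
  -- remains because the new minimum comes last. The last piece is the top active site: in an `E` it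
  -- does not split and reproduces the label, in a `U` it is a new maximum.
  child : State → ℕ → State
  child root    v       = U 0 0
  child (D k)   zero    = D (suc k)
  child (D k)   (suc v) = D (2 + v)
  child (E l j) zero    = D (4 + (l + j))
  child (E l j) (suc v) = piece l D₂ (piece (suc j) (E l) (λ _ → E l j)) v
  child (U l m) zero    = U (suc (l + m)) 0
  child (U l m) (suc v) = piece l D₂ (piece m (E l) (λ _ → U l (suc m))) v

  sumTo : ℕ → (ℕ → ℕ) → ℕ
  sumTo zero    f = 0
  sumTo (suc k) f = f 0 + sumTo k (f ∘ suc)

  descendants : ℕ → State → ℕ
  descendants zero    s = 1
  descendants (suc n) s = sumTo (arity s) (descendants n ∘ child s)

-- Effect of a new last value on activity, splitting and avoidance.

module Insertion where

  open import Data.Nat using (ℕ; zero; suc; _+_; _≤_; _<_; z≤n; s≤s; s≤s⁻¹; _<?_; _≤?_)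
  open import Data.Nat.Properties as ℕ using (≤-trans; ≤-refl; <-irrefl; <-trans; <-≤-trans; ≤-<-trans; ≮⇒≥; ≰⇒>; n≤1+n; <⇒≱)
  open import Data.Fin using (Fin; toℕ; fromℕ; inject₁; punchIn) renaming (zero to fzero; suc to fsuc; _<_ to _<ᶠ_)
  open import Data.Fin.Properties as Fin using (toℕ<n; toℕ-fromℕ; toℕ-inject₁)
  open import Data.Fin.Relation.Unary.Top using (view; ‵fromℕ; ‵inject₁)
  open import Data.Product using (_×_; _,_; proj₁; proj₂; ∃)
  open import Data.Sum using (_⊎_; inj₁; inj₂)
  open import Data.Empty using (⊥-elim)
  open import Function using (_∘_; _⇔_; mk⇔)
  open import Relation.Binary.Definitions using (tri<; tri≈; tri>)
  open import Relation.Binary.PropositionalEquality using (_≡_; refl; sym; trans; cong; subst; subst₂)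
  open import Relation.Nullary using (¬_; yes; no; contradiction)

  -- `punchIn` on plain naturals, so that values and sites for different lengths are compared
  -- without coercions.
  bump : ℕ → ℕ → ℕ
  bump zero    x       = suc x
  bump (suc w) zero    = zero
  bump (suc w) (suc x) = suc (bump w x)

  toℕ-punchIn : ∀ {n} (w : Fin (suc n)) x → toℕ (punchIn w x) ≡ bump (toℕ w) (toℕ x)
  toℕ-punchIn fzero    x        = refl
  toℕ-punchIn (fsuc w) fzero    = refl
  toℕ-punchIn (fsuc w) (fsuc x) = cong suc (toℕ-punchIn w x)

  bump-< : ∀ {w x} → x < w → bump w x ≡ x
  bump-< {suc w} {zero}  _         = refl
  bump-< {suc w} {suc x} (s≤s x<w) = cong suc (bump-< x<w)

  bump-≥ : ∀ {w x} → w ≤ x → bump w x ≡ suc x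
  bump-≥ z≤n       = refl
  bump-≥ (s≤s w≤x) = cong suc (bump-≥ w≤x)

  bump-mono : ∀ w {x y} → x < y → bump w x < bump w y
  bump-mono zero    x<y                       = s≤s x<y
  bump-mono (suc w) {zero}  {suc y} _         = s≤s z≤n
  bump-mono (suc w) {suc x} {suc y} (s≤s x<y) = s≤s (bump-mono w x<y)

  bump-cancel : ∀ w {x y} → bump w x < bump w y → x < y
  bump-cancel zero    (s≤s x<y)                 = x<y
  bump-cancel (suc w) {zero}  {suc y} _         = s≤s z≤n
  bump-cancel (suc w) {suc x} {suc y} (s≤s x<y) = s≤s (bump-cancel w x<y)

  x≤bump : ∀ w x → x ≤ bump w x
  x≤bump zero    x       = n≤1+n x
  x≤bump (suc w) zero    = z≤n
  x≤bump (suc w) (suc x) = s≤s (x≤bump w x)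

  bump≤1+x : ∀ w x → bump w x ≤ suc x
  bump≤1+x zero    x       = ≤-refl
  bump≤1+x (suc w) zero    = z≤n
  bump≤1+x (suc w) (suc x) = s≤s (bump≤1+x w x)

  bump<w : ∀ {w x} → bump w x < w → x < w
  bump<w {w} {x} p = ≤-<-trans (x≤bump w x) p

  w<bump : ∀ {w x} → w < bump w x → w ≤ x
  w<bump {w} {x} p = s≤s⁻¹ (<-≤-trans p (bump≤1+x w x))

  ≤bump⇒≤ : ∀ {v w x} → v ≤ w → v ≤ bump w x → v ≤ x
  ≤bump⇒≤ {v} {w} {x} v≤w v≤b with x <? w
  ... | yes x<w = subst (v ≤_) (bump-< x<w) v≤b
  ... | no  x≮w = ≤-trans v≤w (≮⇒≥ x≮w)

  -- The disjuncts are 4123, 1324 and 3124, each read in increasing order of value.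
  Bad : ℕ → ℕ → ℕ → ℕ → Set
  Bad a b c d = (b < c × c < d × d < a) ⊎ (a < c × c < b × b < d) ⊎ (b < c × c < a × a < d)

  module _ {n} (f : Fin n → ℕ) where

    Avoiding : Set
    Avoiding = ∀ {i j k l} → i <ᶠ j → j <ᶠ k → k <ᶠ l → ¬ Bad (f i) (f j) (f k) (f l)

    -- A last value between the 2 and the 3 of a 312 completes a 4123, one above the 3 completes a
    -- 3124, and one above the 3 of a 132 completes a 1324. Each triple only bounds v from above,
    -- whence `Active-↓`.
    Active : ℕ → Set
    Active v = ∀ i j k → i <ᶠ j → j <ᶠ k →
      (f j < f k → f k < f i → v ≤ f k) × (f i < f k → f k < f j → v ≤ f j)

    Split : ℕ → Set
    Split v = ∀ i j → f i < v → v ≤ f j → i <ᶠ j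

    Onto : Set
    Onto = ∀ {x} → x < n → ∃ λ i → f i ≡ x

    Bounded : Set
    Bounded = ∀ i → f i < n

  inject₁-mono : ∀ {n} {i j : Fin n} → i <ᶠ j → inject₁ i <ᶠ inject₁ j
  inject₁-mono {i = i} {j} = subst₂ _<_ (sym (toℕ-inject₁ i)) (sym (toℕ-inject₁ j))

  inject₁-cancel : ∀ {n} {i j : Fin n} → inject₁ i <ᶠ inject₁ j → i <ᶠ j
  inject₁-cancel {i = i} {j} = subst₂ _<_ (toℕ-inject₁ i) (toℕ-inject₁ j)

  inject₁<last : ∀ {n} (i : Fin n) → inject₁ i <ᶠ fromℕ n
  inject₁<last {n} i = subst₂ _<_ (sym (toℕ-inject₁ i)) (sym (toℕ-fromℕ n)) (toℕ<n i)

  last≮ : ∀ {n} {j : Fin (suc n)} → ¬ (fromℕ n <ᶠ j)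
  last≮ {n} {j} p = <-irrefl (toℕ-fromℕ n) (<-≤-trans p (s≤s⁻¹ (toℕ<n j)))

  Active-↓ : ∀ {n} (f : Fin n → ℕ) {u v} → u ≤ v → Active f v → Active f u
  Active-↓ f u≤v a i j k p q = (λ x y → ≤-trans u≤v (proj₁ (a _ _ _ p q) x y)) , (λ x y → ≤-trans u≤v (proj₂ (a _ _ _ p q) x y))

  module Extension {n} (f : Fin n → ℕ) (w : ℕ) (g : Fin (suc n) → ℕ)
    (old : ∀ i → g (inject₁ i) ≡ bump w (f i)) (new : g (fromℕ n) ≡ w) where

    -- The new entry is last, so in a triple it can only play the 2: of a 312 if the larger value
    -- comes first, of a 132 otherwise.
    Active-intro : ∀ {v} →
      (∀ {i j k} → i <ᶠ j → j <ᶠ k →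
        (f j < f k → f k < f i → v ≤ bump w (f k)) × (f i < f k → f k < f j → v ≤ bump w (f j))) →
      (∀ {i j} → i <ᶠ j → (f j < w → w ≤ f i → v ≤ w) × (f i < w → w ≤ f j → v ≤ bump w (f j))) →
      Active g v
    Active-intro olds news i j k i<j j<k with view i | view j | view k
    ... | ‵fromℕ     | _          | _          = contradiction i<j last≮
    ... | ‵inject₁ i | ‵fromℕ     | _          = contradiction j<k last≮
    ... | ‵inject₁ i | ‵inject₁ j | ‵inject₁ k rewrite old i | old j | old k =
      (λ p q → proj₁ (olds (inject₁-cancel i<j) (inject₁-cancel j<k)) (bump-cancel w p) (bump-cancel w q)) ,
      (λ p q → proj₂ (olds (inject₁-cancel i<j) (inject₁-cancel j<k)) (bump-cancel w p) (bump-cancel w q))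
    ... | ‵inject₁ i | ‵inject₁ j | ‵fromℕ rewrite old i | old j | new =
      (λ p q → proj₁ (news (inject₁-cancel i<j)) (bump<w p) (w<bump q)) ,
      (λ p q → proj₂ (news (inject₁-cancel i<j)) (bump<w p) (w<bump q))

    private
      <w : ∀ {i} → f i < w → g (inject₁ i) < g (fromℕ n)
      <w {i} p = subst₂ _<_ (trans (sym (bump-< p)) (sym (old i))) (sym new) p
      ≥w : ∀ {i} → w ≤ f i → g (fromℕ n) < g (inject₁ i)
      ≥w {i} p = subst₂ _<_ (sym new) (trans (sym (bump-≥ p)) (sym (old i))) (s≤s p)

    Active-312 : ∀ {v i j} → Active g v → i <ᶠ j → f j < w → w ≤ f i → v ≤ w
    Active-312 {v} {i} {j} a i<j p q =
      subst (v ≤_) new (proj₁ (a _ _ _ (inject₁-mono i<j) (inject₁<last j)) (<w p) (≥w q))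

    Active-132 : ∀ {v i j} → Active g v → i <ᶠ j → f i < w → w ≤ f j → v ≤ suc (f j)
    Active-132 {v} {i} {j} a i<j p q =
      subst (v ≤_) (trans (old j) (bump-≥ q)) (proj₂ (a _ _ _ (inject₁-mono i<j) (inject₁<last j)) (<w p) (≥w q))

    Active-≤ : ∀ {v} → v ≤ w → Active f v → Active g v
    Active-≤ v≤w a = Active-intro
      (λ p q → (λ x y → ≤-trans (proj₁ (a _ _ _ p q) x y) (x≤bump w _)) , (λ x y → ≤-trans (proj₂ (a _ _ _ p q) x y) (x≤bump w _)))
      (λ p → (λ _ _ → v≤w) , (λ _ y → ≤-trans v≤w (≤-trans y (x≤bump w _))))

    private
      suc≤bump : ∀ {u x} → w ≤ u → u ≤ x → suc u ≤ bump w x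
      suc≤bump w≤u u≤x = subst (_ ≤_) (sym (bump-≥ (≤-trans w≤u u≤x))) (s≤s u≤x)

    -- When w splits, no value from w upwards precedes one below w, so the new entry ends no 312.
    -- All remaining bounds come from old values that are at least w, and these are raised above w.
    Active-split : Split f w → Active f w → Active g (suc w)
    Active-split s a = Active-intro
      (λ p q → (λ x y → suc≤bump ≤-refl (proj₁ (a _ _ _ p q) x y)) , (λ x y → suc≤bump ≤-refl (proj₂ (a _ _ _ p q) x y)))
      (λ p → (λ x y → contradiction (<-trans p (s _ _ x y)) (<-irrefl refl)) , (λ _ y → suc≤bump ≤-refl y))

    Active-zero : ∀ {u} → w ≡ 0 → Active f u → Active g (suc u)
    Active-zero refl a = Active-intro
      (λ p q → (λ x y → s≤s (proj₁ (a _ _ _ p q) x y)) , (λ x y → s≤s (proj₂ (a _ _ _ p q) x y)))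
      (λ p → (λ ()) , (λ ()))

    Active-zero⁻ : ∀ {u} → w ≡ 0 → Active g (suc u) → Active f u
    Active-zero⁻ refl a i j k p q =
      (λ x y → s≤s⁻¹ (subst (_ ≤_) (old k) (proj₁ (a _ _ _ (inject₁-mono p) (inject₁-mono q)) (lift x) (lift y)))) ,
      (λ x y → s≤s⁻¹ (subst (_ ≤_) (old j) (proj₂ (a _ _ _ (inject₁-mono p) (inject₁-mono q)) (lift x) (lift y))))
      where
      lift : ∀ {i j} → f i < f j → g (inject₁ i) < g (inject₁ j)
      lift {i} {j} p = subst₂ _<_ (sym (old i)) (sym (old j)) (s≤s p)

    Active-top : ∀ {v} → (∀ i → f i < w) → Active f v → Active g v
    Active-top b a = Active-intro
      (λ p q → (λ x y → ≤-trans (proj₁ (a _ _ _ p q) x y) (x≤bump w _)) , (λ x y → ≤-trans (proj₂ (a _ _ _ p q) x y) (x≤bump w _)))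
      (λ p → (λ _ y → contradiction y (<⇒≱ (b _))) , (λ _ y → contradiction y (<⇒≱ (b _))))

    -- A value from w upwards that precedes one below w forms a 312 with the new entry as its 2,
    -- which bounds v by w. Without such a pair w would split.
    Active-nonsplit⁻ : ∀ {v} → ¬ Split f w → Active g v → v ≤ w
    Active-nonsplit⁻ {v} ¬s a with v ≤? w
    ... | yes v≤w = v≤w
    ... | no  v≰w = contradiction split ¬s
      where
      split : Split f w
      split i j p q with Fin.<-cmp i j
      ... | tri< i<j _ _    = i<j
      ... | tri≈ _ refl _   = contradiction q (<⇒≱ p)
      ... | tri> _ _ j<i    = contradiction (Active-312 a j<i p q) v≰w

    -- The values 0 and w both occur. If 0 comes first, they and the new entry form a 132 whose 3
    -- has been raised to w + 1; if w comes first, they form a 312 whose 2 is w.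
    Active-inner⁻ : ∀ {v} → Onto f → 0 < w → w < n → Active g v → v ≤ suc w
    Active-inner⁻ {v} onto 0<w w<n a with onto (<-trans 0<w w<n) | onto w<n
    ... | i , fi≡0 | j , fj≡w with Fin.<-cmp i j
    ...   | tri< i<j _ _  = subst (λ x → v ≤ suc x) fj≡w (Active-132 a i<j (subst (_< w) (sym fi≡0) 0<w) (ℕ.≤-reflexive (sym fj≡w)))
    ...   | tri≈ _ refl _ = contradiction (trans (sym fi≡0) fj≡w) (ℕ.<⇒≢ 0<w)
    ...   | tri> _ _ j<i  = ≤-trans (Active-312 a j<i (subst (_< w) (sym fi≡0) 0<w) (ℕ.≤-reflexive (sym fj≡w))) (n≤1+n w)

    Split-≤ : ∀ {v} → v ≤ w → Split g v ⇔ Split f v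
    Split-≤ {v} v≤w = mk⇔ restrict extend
      where
      restrict : Split g v → Split f v
      restrict s i j p q = inject₁-cancel (s _ _
        (subst (_< v) (trans (sym (bump-< (<-≤-trans p v≤w))) (sym (old i))) p)
        (subst (v ≤_) (sym (old j)) (≤-trans q (x≤bump w (f j)))))
      extend : Split f v → Split g v
      extend s i j p q with view i | view j
      ... | ‵fromℕ     | _          = contradiction v≤w (<⇒≱ (subst (_< v) new p))
      ... | ‵inject₁ i | ‵fromℕ     = inject₁<last i
      ... | ‵inject₁ i | ‵inject₁ j rewrite old i | old j =
        inject₁-mono (s i j (≤-<-trans (x≤bump w (f i)) p) (≤bump⇒≤ v≤w q))

    -- The entry of value v - 1 is raised to v, and the smaller new entry comes after it.
    ¬Split-> : ∀ {v} → Onto f → w < v → v ≤ n → ¬ Split g v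
    ¬Split-> {suc u} onto (s≤s w≤u) u<n s with onto u<n
    ... | j , refl = last≮ (s (fromℕ n) (inject₁ j) (subst (_< suc u) (sym new) (s≤s w≤u))
                                                    (ℕ.≤-reflexive (sym (trans (old j) (bump-≥ w≤u)))))

    Bounded-ext : Bounded f → w ≤ n → Bounded g
    Bounded-ext b w≤n i with view i
    ... | ‵fromℕ     rewrite new   = s≤s w≤n
    ... | ‵inject₁ i rewrite old i = s≤s (≤-trans (bump≤1+x w (f i)) (b i))

    Split-top : ∀ {v} → Bounded f → w ≤ n → n < v → Split g v
    Split-top b w≤n n<v _ j _ q = contradiction (≤-trans n<v q) (<⇒≱ (Bounded-ext b w≤n j))

    Onto-ext : Onto f → w ≤ n → Onto g
    Onto-ext onto w≤n {x} x≤n with ℕ.<-cmp x w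
    ... | tri< x<w _ _ = let i , fi≡x = onto (<-≤-trans x<w w≤n) in
                         inject₁ i , trans (old i) (trans (cong (bump w) fi≡x) (bump-< x<w))
    ... | tri≈ _ refl _ = fromℕ n , new
    Onto-ext onto w≤n {suc x} (s≤s x<n) | tri> _ _ (s≤s w≤x) = let i , fi≡x = onto x<n in
                         inject₁ i , trans (old i) (trans (cong (bump w) fi≡x) (bump-≥ w≤x))

    Avoiding⁺ : Avoiding f → Active f w → Avoiding g
    Avoiding⁺ av a {i} {j} {k} {l} i<j j<k k<l with view i | view j | view k | view l
    ... | ‵fromℕ     | _          | _          | _      = contradiction i<j last≮
    ... | ‵inject₁ i | ‵fromℕ     | _          | _      = contradiction j<k last≮
    ... | ‵inject₁ i | ‵inject₁ j | ‵fromℕ     | _      = contradiction k<l last≮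
    ... | ‵inject₁ i | ‵inject₁ j | ‵inject₁ k | ‵inject₁ l rewrite old i | old j | old k | old l =
      av (inject₁-cancel i<j) (inject₁-cancel j<k) (inject₁-cancel k<l) ∘ λ where
        (inj₁ (p , q , r))        → inj₁ (bump-cancel w p , bump-cancel w q , bump-cancel w r)
        (inj₂ (inj₁ (p , q , r))) → inj₂ (inj₁ (bump-cancel w p , bump-cancel w q , bump-cancel w r))
        (inj₂ (inj₂ (p , q , r))) → inj₂ (inj₂ (bump-cancel w p , bump-cancel w q , bump-cancel w r))
    ... | ‵inject₁ i | ‵inject₁ j | ‵inject₁ k | ‵fromℕ rewrite old i | old j | old k | new = λ where
        (inj₁ (p , q , r))        → <⇒≱ (bump<w q) (312-active (bump-cancel w p) (bump-cancel w (<-trans q r)))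
        (inj₂ (inj₁ (p , q , r))) → <⇒≱ (bump<w r) (132-active (bump-cancel w p) (bump-cancel w q))
        (inj₂ (inj₂ (p , q , r))) → <⇒≱ (bump<w (<-trans q r)) (312-active (bump-cancel w p) (bump-cancel w q))
      where
      312-active = proj₁ (a _ _ _ (inject₁-cancel i<j) (inject₁-cancel j<k))
      132-active = proj₂ (a _ _ _ (inject₁-cancel i<j) (inject₁-cancel j<k))

    Avoiding⁻ : Avoiding g → Avoiding f × Active f w
    Avoiding⁻ av = restrict , active
      where
      restrict : Avoiding f
      restrict {i} {j} {k} {l} i<j j<k k<l = av (inject₁-mono i<j) (inject₁-mono j<k) (inject₁-mono k<l) ∘ lifted
        where
        lifted : Bad (f i) (f j) (f k) (f l) → Bad (g (inject₁ i)) (g (inject₁ j)) (g (inject₁ k)) (g (inject₁ l))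
        lifted rewrite old i | old j | old k | old l = λ where
          (inj₁ (p , q , r))        → inj₁ (bump-mono w p , bump-mono w q , bump-mono w r)
          (inj₂ (inj₁ (p , q , r))) → inj₂ (inj₁ (bump-mono w p , bump-mono w q , bump-mono w r))
          (inj₂ (inj₂ (p , q , r))) → inj₂ (inj₂ (bump-mono w p , bump-mono w q , bump-mono w r))
      lift : ∀ {i j} → f i < f j → g (inject₁ i) < g (inject₁ j)
      lift {i} {j} p = subst₂ _<_ (sym (old i)) (sym (old j)) (bump-mono w p)
      active : Active f w
      active i j k i<j j<k = above-312 , above-132
        where
        avoid = av (inject₁-mono i<j) (inject₁-mono j<k) (inject₁<last k)
        above-312 : f j < f k → f k < f i → w ≤ f k
        above-312 p q with w ≤? f k | w ≤? f i
        ... | yes w≤fk | _        = w≤fk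
        ... | no  w≰fk | yes w≤fi = ⊥-elim (avoid (inj₁ (lift p , <w (≰⇒> w≰fk) , ≥w w≤fi)))
        ... | no  w≰fk | no  w≰fi = ⊥-elim (avoid (inj₂ (inj₂ (lift p , lift q , <w (≰⇒> w≰fi)))))
        above-132 : f i < f k → f k < f j → w ≤ f j
        above-132 p q with w ≤? f j
        ... | yes w≤fj = w≤fj
        ... | no  w≰fj = ⊥-elim (avoid (inj₂ (inj₁ (lift p , lift q , <w (≰⇒> w≰fj)))))

-- The labels describe the active and the splitting sites.

module NodeInvariant where

  open GeneratingTree
  open Insertion
  open import Data.Nat using (ℕ; zero; suc; _+_; _≤_; _<_; z≤n; s≤s; s≤s⁻¹; _≤?_)
  open import Data.Nat.Properties as ℕ using (≤-trans; ≤-refl; <-trans; <-≤-trans; ≤-<-trans; ≰⇒>; n≤1+n; m<n⇒m<1+n; <⇒≱)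
  open import Data.Fin using (fromℕ; inject₁)
  open import Data.Product using (_×_; _,_; proj₁; proj₂; ∃)
  open import Data.Sum using (_⊎_; inj₁; inj₂)
  open import Data.Empty using (⊥; ⊥-elim)
  open import Function using (_∘_; _⇔_; mk⇔; Equivalence)
  open import Relation.Binary.PropositionalEquality using (_≡_; refl; sym; trans; cong; subst)
  open import Relation.Nullary using (¬_; yes; no; contradiction)
  open Equivalence using (to; from)

  -- With `k≤n` the top site is inactive, so some 312 or 132 is present. Splitting is recorded only
  -- where a later insertion depends on it; site 0 splits vacuously.
  record Threshold {n} (f : Fin n → ℕ) (k : ℕ) (P : ℕ → Set) : Set where
    field
      k≤n    : k ≤ n
      active : ∀ v → Active f v ⇔ v < k
      split  : ∀ v → 0 < v → v < k → Split f v ⇔ P v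

  -- For a `U`, activity of every natural number, also beyond n, says that there is neither a 312
  -- nor a 132.
  Invariant : ∀ {n} → State → (Fin n → ℕ) → Set
  Invariant {n} root    f = n ≡ 0
  Invariant     (D k)   f = Threshold f k (λ _ → ⊥)
  Invariant     (E l j) f = Threshold f (3 + (l + j)) (λ v → l < v × v ≤ suc (l + j))
  Invariant {n} (U l m) f = n ≡ suc (l + m) × (∀ v → Active f v) × (∀ v → 0 < v → v ≤ n → Split f v ⇔ l < v)

  arity-E : ∀ l j → arity (E l j) ≡ 3 + (l + j)
  arity-E l j = cong suc (trans (cong (_+_ l) (ℕ.+-comm (suc j) 1)) (trans (ℕ.+-suc l (suc j)) (cong suc (ℕ.+-suc l j))))

  arity-U : ∀ l m → arity (U l m) ≡ 2 + (l + m)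
  arity-U l m = cong suc (trans (cong (_+_ l) (ℕ.+-comm m 1)) (ℕ.+-suc l m))

  arity≤ : ∀ {n} s {f : Fin n → ℕ} → Invariant s f → arity s ≤ suc n
  arity≤ root    _          = s≤s z≤n
  arity≤ (D k)   t          = ≤-trans (Threshold.k≤n t) (n≤1+n _)
  arity≤ (E l j) t          rewrite arity-E l j = ≤-trans (Threshold.k≤n t) (n≤1+n _)
  arity≤ (U l m) (refl , _) = ℕ.≤-reflexive (arity-U l m)

  no-triples : ∀ {f : Fin 0 → ℕ} v → Active f v
  no-triples v ()

  Active⇔<arity : ∀ {n} s {f : Fin n → ℕ} → Invariant s f → ∀ {v} → v ≤ n → Active f v ⇔ v < arity s
  Active⇔<arity root    refl z≤n = mk⇔ (λ _ → s≤s z≤n) (λ _ → no-triples 0)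
  Active⇔<arity (D k)   t _ = Threshold.active t _
  Active⇔<arity (E l j) t _ rewrite arity-E l j = Threshold.active t _
  Active⇔<arity (U l m) (refl , a , _) v≤n rewrite arity-U l m = mk⇔ (λ _ → s≤s v≤n) (λ _ → a _)

  ⇔⊥ : ∀ {A : Set} → ¬ A → A ⇔ ⊥
  ⇔⊥ ¬a = mk⇔ ¬a ⊥-elim

  ⇔-both : ∀ {A B : Set} → A → B → A ⇔ B
  ⇔-both a b = mk⇔ (λ _ → b) (λ _ → a)

  ⇔-neither : ∀ {A B : Set} → ¬ A → ¬ B → A ⇔ B
  ⇔-neither ¬a ¬b = mk⇔ (λ a → contradiction a ¬a) (λ b → contradiction b ¬b)

  ⇔-trans : ∀ {A B C : Set} → A ⇔ B → B ⇔ C → A ⇔ C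
  ⇔-trans p q = mk⇔ (to q ∘ to p) (from p ∘ from q)

  piece-case : ∀ {A : Set} l {r} (f g : ℕ → A) {v} → v < l + r →
    (v < l × piece l f g v ≡ f v) ⊎ (∃ λ t → t < r × v ≡ l + t × piece l f g v ≡ g t)
  piece-case zero    f g {v}     v<r       = inj₂ (v , v<r , refl , refl)
  piece-case (suc l) f g {zero}  _         = inj₁ (s≤s z≤n , refl)
  piece-case (suc l) f g {suc v} (s≤s v<l+r) with piece-case l (f ∘ suc) g v<l+r
  ... | inj₁ (v<l , eq)            = inj₁ (s≤s v<l , eq)
  ... | inj₂ (t , t<r , refl , eq) = inj₂ (t , t<r , refl , eq)

  module Step {n} (f : Fin n → ℕ) (w : ℕ) (g : Fin (suc n) → ℕ)
    (old : ∀ i → g (inject₁ i) ≡ bump w (f i)) (new : g (fromℕ n) ≡ w)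
    (bounded : Bounded f) (onto : Onto f) where

    open Extension f w g old new

    threshold-zero : ∀ {k P} → w ≡ 0 → Threshold f k P → Threshold g (suc k) (λ _ → ⊥)
    threshold-zero {k} refl t = record
      { k≤n    = s≤s k≤n
      ; active = λ where
          zero    → ⇔-both (Active-≤ z≤n (to-active k≤n)) (s≤s z≤n)
          (suc u) → mk⇔ (s≤s ∘ to (active u) ∘ Active-zero⁻ refl) (Active-zero refl ∘ from (active u) ∘ s≤s⁻¹)
      ; split  = λ v 0<v v≤k → ⇔⊥ (¬Split-> onto 0<v (≤-trans (s≤s⁻¹ v≤k) k≤n))
      }
      where
      open Threshold t
      to-active : k ≤ n → Active f 0
      to-active _ _ _ _ _ _ = (λ _ _ → z≤n) , (λ _ _ → z≤n)

    threshold-nonsplit : ∀ {P} → w < n → Active f w → ¬ Split f w →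
      (∀ v → 0 < v → v ≤ w → Split f v ⇔ P v) → Threshold g (suc w) P
    threshold-nonsplit w<n a ¬s splits = record
      { k≤n    = m<n⇒m<1+n w<n
      ; active = λ v → mk⇔ (λ a′ → s≤s (Active-nonsplit⁻ ¬s a′)) (λ v<1+w → Active-≤ (s≤s⁻¹ v<1+w) (Active-↓ f (s≤s⁻¹ v<1+w) a))
      ; split  = λ v 0<v v<1+w → ⇔-trans (Split-≤ (s≤s⁻¹ v<1+w)) (splits v 0<v (s≤s⁻¹ v<1+w))
      }

    -- The additional active site w + 1 lies above the new last entry and hence does not split; this
    -- is the reason for the bound v ≤ w.
    threshold-split : ∀ {P : ℕ → Set} → 0 < w → w < n → Active f w → Split f w →
      (∀ v → 0 < v → v ≤ w → Split f v ⇔ P v) → Threshold g (2 + w) (λ v → P v × v ≤ w)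
    threshold-split {P} 0<w w<n a s splits = record
      { k≤n    = s≤s w<n
      ; active = λ v → mk⇔ (λ a′ → s≤s (Active-inner⁻ onto 0<w w<n a′)) (λ v<2+w → Active-↓ g (s≤s⁻¹ v<2+w) (Active-split s a))
      ; split  = split
      }
      where
      split : ∀ v → 0 < v → v < 2 + w → Split g v ⇔ (P v × v ≤ w)
      split v 0<v v<2+w with v ≤? w
      ... | yes v≤w = ⇔-trans (Split-≤ v≤w) (mk⇔ (λ s → to (splits v 0<v v≤w) s , v≤w) (from (splits v 0<v v≤w) ∘ proj₁))
      ... | no  v≰w = ⇔-neither (¬Split-> onto (≰⇒> v≰w) (≤-trans (s≤s⁻¹ v<2+w) w<n)) (v≰w ∘ proj₂)

    all-active-zero : w ≡ 0 → (∀ v → Active f v) → ∀ v → Active g v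
    all-active-zero refl a zero    = Active-≤ z≤n (a 0)
    all-active-zero refl a (suc v) = Active-zero refl (a v)

    step : ∀ s → Invariant s f → Active f w → w < arity s → Invariant (child s w) g
    step root    refl _ (s≤s z≤n) = refl , all-active-zero refl no-triples ,
      λ v 0<v v≤1 → ⇔-both (Split-top bounded z≤n 0<v) 0<v
    step (D k) t a w<k = go w refl w<k
      where
      go : ∀ v → w ≡ v → v < k → Invariant (child (D k) v) g
      go zero    w≡0  _   = threshold-zero w≡0 t
      go (suc v) refl v<k = threshold-nonsplit (<-≤-trans v<k (Threshold.k≤n t)) a (to (Threshold.split t w (s≤s z≤n) v<k))
        λ u 0<u u≤w → Threshold.split t u 0<u (≤-<-trans u≤w v<k)
    step (E l j) t a w<k = go w refl (subst (w <_) (arity-E l j) w<k)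
      where
      open Threshold t
      split-at : ∀ {u} → 0 < u → u < 3 + (l + j) → Split f u ⇔ (l < u × u ≤ suc (l + j))
      split-at = split _
      go : ∀ v → w ≡ v → v < 3 + (l + j) → Invariant (child (E l j) v) g
      go zero    w≡0  _   = threshold-zero w≡0 t
      go (suc v) refl w<k with piece-case l {suc j + 1} D₂ (piece (suc j) (E l) (λ _ → E l j)) {v}
                                (s≤s⁻¹ (subst (suc v <_) (sym (arity-E l j)) w<k))
      ... | inj₁ (v<l , eq) rewrite eq =
        threshold-nonsplit (<-≤-trans w<k k≤n) a (λ s → <⇒≱ v<l (s≤s⁻¹ (proj₁ (to (split-at (s≤s z≤n) w<k) s))))
          λ u 0<u u≤w → ⇔⊥ λ s → <⇒≱ (≤-trans (s≤s v<l) (proj₁ (to (split-at 0<u (≤-<-trans u≤w w<k)) s))) u≤w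
      ... | inj₂ (t′ , t′<r , refl , eq) rewrite eq with piece-case (suc j) {1} (E l) (λ _ → E l j) t′<r
      ...   | inj₁ (s≤s t′≤j , eq′) rewrite eq′ =
        threshold-split (s≤s z≤n) (<-≤-trans w<k k≤n) a
          (from (split-at (s≤s z≤n) w<k) (s≤s (ℕ.m≤m+n l t′) , s≤s (ℕ.+-monoʳ-≤ l t′≤j)))
          λ u 0<u u≤w → mk⇔ (proj₁ ∘ to (split-at 0<u (≤-<-trans u≤w w<k)))
            (λ l<u → from (split-at 0<u (≤-<-trans u≤w w<k)) (l<u , ≤-trans u≤w (s≤s (ℕ.+-monoʳ-≤ l t′≤j))))
      -- Here w is the top active site l + j + 2, one above the last splitting site. Being
      -- nonsplitting, it leaves exactly 0 ... w active, so the label repeats.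
      ...   | inj₂ (zero , _ , refl , eq′) rewrite eq′ =
        subst (λ k → Threshold g k (λ v → l < v × v ≤ suc (l + j))) w+1
          (threshold-nonsplit (<-≤-trans w<k k≤n) a
            (λ s → <⇒≱ ≤-refl (subst (_≤ suc (l + j)) (ℕ.suc-injective w+1) (proj₂ (to (split-at (s≤s z≤n) w<k) s))))
            λ u 0<u u≤w → split-at 0<u (≤-<-trans u≤w w<k))
        where
        w+1 : suc (suc (l + (suc j + 0))) ≡ 3 + (l + j)
        w+1 = cong (suc ∘ suc) (trans (cong (_+_ l) (ℕ.+-identityʳ (suc j))) (ℕ.+-suc l j))
      ...   | inj₂ (suc _ , s≤s () , _)
    step (U l m) (refl , all , split) a w<k = go w refl (subst (w <_) (arity-U l m) w<k)
      where
      go : ∀ v → w ≡ v → v < 2 + (l + m) → Invariant (child (U l m) v) g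
      -- The new minimum comes last and undoes every old positive split, so among the positive sites
      -- only the new top one splits.
      go zero    refl _   = cong (suc ∘ suc) (sym (ℕ.+-identityʳ (l + m))) , all-active-zero refl all , splits
        where
        splits : ∀ v → 0 < v → v ≤ 2 + (l + m) → Split g v ⇔ suc (l + m) < v
        splits v 0<v v≤ with v ≤? suc (l + m)
        ... | yes v≤n = ⇔-neither (¬Split-> onto 0<v v≤n) (λ n<v → <⇒≱ n<v v≤n)
        ... | no  v≰n = ⇔-both (Split-top bounded z≤n (≰⇒> v≰n)) (≰⇒> v≰n)
      go (suc v) refl w<k with piece-case l {m + 1} D₂ (piece m (E l) (λ _ → U l (suc m))) {v}
                                (s≤s⁻¹ (subst (suc v <_) (sym (arity-U l m)) w<k))
      ... | inj₁ (v<l , eq) rewrite eq =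
        threshold-nonsplit (s≤s (≤-trans v<l (ℕ.m≤m+n l m))) a
          (λ s → <⇒≱ v<l (s≤s⁻¹ (to (split w (s≤s z≤n) (s≤s⁻¹ w<k)) s)))
          λ u 0<u u≤w → ⇔⊥ λ s → <⇒≱ (≤-trans (s≤s v<l) (to (split u 0<u (≤-trans u≤w (s≤s⁻¹ w<k))) s)) u≤w
      ... | inj₂ (t , t<r , refl , eq) rewrite eq with piece-case m {1} (E l) (λ _ → U l (suc m)) t<r
      ...   | inj₁ (t<m , eq′) rewrite eq′ =
        threshold-split (s≤s z≤n) (s≤s (ℕ.+-monoʳ-< l t<m)) a
          (from (split w (s≤s z≤n) (s≤s⁻¹ w<k)) (s≤s (ℕ.m≤m+n l t)))
          λ u 0<u u≤w → split u 0<u (≤-trans u≤w (s≤s⁻¹ w<k))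
      -- The site w = n inserts a new maximum at the end: no triple arises, old splits persist, and
      -- the new top site splits as well.
      ...   | inj₂ (zero , _ , refl , eq′) rewrite eq′ =
        cong suc (sym (ℕ.+-suc l m)) , (λ v → Active-top bounded′ (all v)) , splits
        where
        w≡n : suc (l + (m + 0)) ≡ suc (l + m)
        w≡n = cong (suc ∘ (_+_ l)) (ℕ.+-identityʳ m)
        bounded′ : ∀ i → f i < w
        bounded′ i = subst (f i <_) (sym w≡n) (bounded i)
        splits : ∀ v → 0 < v → v ≤ 2 + (l + m) → Split g v ⇔ l < v
        splits v 0<v v≤ with v ≤? suc (l + m)
        ... | yes v≤n = ⇔-trans (Split-≤ (subst (v ≤_) (sym w≡n) v≤n)) (split v 0<v v≤n)
        ... | no  v≰n = ⇔-both (Split-top bounded (ℕ.≤-reflexive w≡n) (≰⇒> v≰n)) (<-trans (s≤s (ℕ.m≤m+n l m)) (≰⇒> v≰n))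
      ...   | inj₂ (suc _ , s≤s () , _)

-- The levels of the tree enumerate the class.

module Enumeration where

  open GeneratingTree
  open Insertion
  open NodeInvariant
  open import Data.Nat using (ℕ; zero; suc; _+_; _≤_; _<_; z≤n; s≤s; s≤s⁻¹)
  import Data.Nat.Properties as ℕ
  open import Data.Fin using (Fin; toℕ; fromℕ; inject₁; punchIn; punchOut) renaming (zero to fzero; suc to fsuc; _<_ to _<ᶠ_)
  open import Data.Fin.Properties as Fin using (toℕ<n; punchIn-injective; punchInᵢ≢i; punchIn-punchOut; fromℕ≢inject₁; inject₁-injective)
  open import Data.Fin.Patterns using (0F; 1F; 2F; 3F)
  open import Data.Fin.Relation.Unary.Top using (view; ‵fromℕ; ‵inject₁)
  open import Data.List using (List; []; _∷_; _++_; map; length; concatMap)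
  open import Data.List.Properties using (length-map; map-∘)
  open import Data.List.Membership.Propositional using (_∈_)
  open import Data.List.Membership.Propositional.Properties using (∈-map⁺; ∈-map⁻; ∈-concatMap⁺)
  open import Data.List.Membership.Propositional.Properties.WithK using (unique∧set⇒bag)
  open import Data.List.Relation.Binary.BagAndSetEquality using (∼bag⇒↭)
  open import Data.List.Relation.Binary.Permutation.Propositional.Properties using (↭-length)
  open import Data.List.Relation.Unary.All as All using (All; []; _∷_)
  import Data.List.Relation.Unary.All.Properties as All
  open import Data.List.Relation.Unary.AllPairs as AllPairs using (AllPairs; []; _∷_)
  import Data.List.Relation.Unary.AllPairs.Properties as AllPairs
  open import Data.List.Relation.Unary.Any as Any using (Any; here; there)
  open import Data.List.Relation.Unary.Unique.Propositional using (Unique)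
  import Data.List.Relation.Unary.Unique.Propositional.Properties as Unique
  open import Data.Product using (_×_; _,_; proj₁; proj₂; ∃)
  open import Data.Sum using (inj₁; inj₂)
  open import Data.Vec using (Vec; lookup; tabulate; _∷ʳ_; initLast) renaming ([] to []ᵛ; _∷_ to _∷ᵛ_; map to mapᵛ)
  open import Data.Vec.Properties using (lookup-map; lookup∘tabulate; tabulate∘lookup; tabulate-cong; ∷ʳ-injective; ∷-injective)
  open import Function using (_∘_; _⇔_; mk⇔; Equivalence)
  open import Relation.Binary.Definitions using (Transitive; tri<; tri≈; tri>)
  open import Relation.Binary.PropositionalEquality using (_≡_; _≢_; refl; sym; trans; cong; cong₂; subst₂)
  open import Relation.Nullary using (contradiction)
  open Equivalence using (to; from)

  val : ∀ {n} → Vec (Fin n) n → Fin n → ℕ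
  val σ i = toℕ (lookup σ i)

  increasing₄ : ∀ {A : Set} {_≺_ : A → A → Set} → Transitive _≺_ → ∀ {a b c d} → a ≺ b → b ≺ c → c ≺ d →
    ∀ i j → i <ᶠ j → lookup (a ∷ᵛ b ∷ᵛ c ∷ᵛ d ∷ᵛ []ᵛ) i ≺ lookup (a ∷ᵛ b ∷ᵛ c ∷ᵛ d ∷ᵛ []ᵛ) j
  increasing₄ tr ab bc cd 0F                1F                _ = ab
  increasing₄ tr ab bc cd 0F                2F         _ = tr ab bc
  increasing₄ tr ab bc cd 0F                3F  _ = tr ab (tr bc cd)
  increasing₄ tr ab bc cd 1F         2F         _ = bc
  increasing₄ tr ab bc cd 1F         3F  _ = tr bc cd
  increasing₄ tr ab bc cd 2F  3F  _ = cd
  increasing₄ tr ab bc cd 1F 1F (s≤s ())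
  increasing₄ tr ab bc cd (fsuc (fsuc i)) 1F (s≤s ())
  increasing₄ tr ab bc cd (fsuc (fsuc i)) 2F (s≤s (s≤s ()))
  increasing₄ tr ab bc cd (fsuc (fsuc (fsuc i))) 3F (s≤s (s≤s (s≤s ())))

  -- The four values are listed by rank, and π gives the rank found at each position. Monotonicity
  -- in the rank yields one direction of the order isomorphism, and trichotomy the other.
  contains : ∀ {n} (σ : Vec (Fin n) n) (π : Vec (Fin 4) 4) {i j k l} → i <ᶠ j → j <ᶠ k → k <ᶠ l →
    ∀ {r₀ r₁ r₂ r₃} → r₀ < r₁ → r₁ < r₂ → r₂ < r₃ →
    (∀ x → val σ (lookup (i ∷ᵛ j ∷ᵛ k ∷ᵛ l ∷ᵛ []ᵛ) x) ≡ lookup (r₀ ∷ᵛ r₁ ∷ᵛ r₂ ∷ᵛ r₃ ∷ᵛ []ᵛ) (lookup π x)) →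
    Contains σ π
  contains σ π {i} {j} {k} {l} i<j j<k k<l {r₀} {r₁} {r₂} {r₃} p q r ranks =
    lookup (i ∷ᵛ j ∷ᵛ k ∷ᵛ l ∷ᵛ []ᵛ) , increasing₄ {_≺_ = _<ᶠ_} ℕ.<-trans i<j j<k k<l , λ x y → mk⇔ (forward x y) (backward x y)
    where
    R : Fin 4 → ℕ
    R = lookup (r₀ ∷ᵛ r₁ ∷ᵛ r₂ ∷ᵛ r₃ ∷ᵛ []ᵛ)
    at : Fin 4 → ℕ
    at x = val σ (lookup (i ∷ᵛ j ∷ᵛ k ∷ᵛ l ∷ᵛ []ᵛ) x)
    R-mono : ∀ x y → x <ᶠ y → R x < R y
    R-mono = increasing₄ {_≺_ = _<_} ℕ.<-trans p q r
    forward : ∀ x y → lookup π x <ᶠ lookup π y → at x < at y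
    forward x y lt = subst₂ _<_ (sym (ranks x)) (sym (ranks y)) (R-mono _ _ lt)
    backward : ∀ x y → at x < at y → lookup π x <ᶠ lookup π y
    backward x y lt with Fin.<-cmp (lookup π x) (lookup π y)
    ... | tri< a _ _  = a
    ... | tri≈ _ eq _ = contradiction lt (ℕ.<-irrefl (trans (ranks x) (trans (cong R eq) (sym (ranks y)))))
    ... | tri> _ _ gt = contradiction lt (ℕ.<⇒≯ (forward y x gt))

  Avoids⇒Avoiding : ∀ {n} (σ : Vec (Fin n) n) → Avoids σ basis → Avoiding (val σ)
  Avoids⇒Avoiding σ (av4123 ∷ av1324 ∷ av3124 ∷ []) i<j j<k k<l = λ where
    (inj₁ (p , q , r))        → av4123 (contains σ p4123 i<j j<k k<l p q r λ { 0F → refl ; 1F → refl ; 2F → refl ; 3F → refl })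
    (inj₂ (inj₁ (p , q , r))) → av1324 (contains σ p1324 i<j j<k k<l p q r λ { 0F → refl ; 1F → refl ; 2F → refl ; 3F → refl })
    (inj₂ (inj₂ (p , q , r))) → av3124 (contains σ p3124 i<j j<k k<l p q r λ { 0F → refl ; 1F → refl ; 2F → refl ; 3F → refl })

  0<1 : _<ᶠ_ {4} {4} 0F 1F
  0<1 = s≤s z≤n
  1<2 : _<ᶠ_ {4} {4} 1F 2F
  1<2 = s≤s (s≤s z≤n)
  2<3 : _<ᶠ_ {4} {4} 2F 3F
  2<3 = s≤s (s≤s (s≤s z≤n))

  Avoiding⇒Avoids : ∀ {n} (σ : Vec (Fin n) n) → Avoiding (val σ) → Avoids σ basis
  Avoiding⇒Avoids σ av =
      (λ (f , mono , iff) → av (mono _ _ 0<1) (mono _ _ 1<2) (mono _ _ 2<3) (inj₁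
        (to (iff 1F 2F) 0<1 , to (iff 2F 3F) 1<2 , to (iff 3F 0F) 2<3)))
    ∷ (λ (f , mono , iff) → av (mono _ _ 0<1) (mono _ _ 1<2) (mono _ _ 2<3) (inj₂ (inj₁
        (to (iff 0F 2F) 0<1 , to (iff 2F 1F) 1<2 , to (iff 1F 3F) 2<3))))
    ∷ (λ (f , mono , iff) → av (mono _ _ 0<1) (mono _ _ 1<2) (mono _ _ 2<3) (inj₂ (inj₂
        (to (iff 1F 2F) 0<1 , to (iff 2F 0F) 1<2 , to (iff 0F 3F) 2<3))))
    ∷ []

  lookup-∷ʳ-inject₁ : ∀ {A : Set} {n} (xs : Vec A n) x i → lookup (xs ∷ʳ x) (inject₁ i) ≡ lookup xs i
  lookup-∷ʳ-inject₁ (y ∷ᵛ xs) x fzero    = refl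
  lookup-∷ʳ-inject₁ (y ∷ᵛ xs) x (fsuc i) = lookup-∷ʳ-inject₁ xs x i

  lookup-∷ʳ-fromℕ : ∀ {A : Set} {n} (xs : Vec A n) x → lookup (xs ∷ʳ x) (fromℕ n) ≡ x
  lookup-∷ʳ-fromℕ []ᵛ       x = refl
  lookup-∷ʳ-fromℕ (y ∷ᵛ xs) x = lookup-∷ʳ-fromℕ xs x

  extend : ∀ {n} → Vec (Fin n) n → Fin (suc n) → Vec (Fin (suc n)) (suc n)
  extend σ w = mapᵛ (punchIn w) σ ∷ʳ w

  lookup-extend : ∀ {n} (σ : Vec (Fin n) n) w i → lookup (extend σ w) (inject₁ i) ≡ punchIn w (lookup σ i)
  lookup-extend σ w i = trans (lookup-∷ʳ-inject₁ (mapᵛ (punchIn w) σ) w i) (lookup-map i (punchIn w) σ)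

  lookup-extend-last : ∀ {n} (σ : Vec (Fin n) n) w → lookup (extend σ w) (fromℕ n) ≡ w
  lookup-extend-last σ w = lookup-∷ʳ-fromℕ (mapᵛ (punchIn w) σ) w

  module _ {n} (σ : Vec (Fin n) n) (w : Fin (suc n)) where

    val-extend : ∀ i → val (extend σ w) (inject₁ i) ≡ bump (toℕ w) (val σ i)
    val-extend i = trans (cong toℕ (lookup-extend σ w i)) (toℕ-punchIn w (lookup σ i))

    val-extend-last : val (extend σ w) (fromℕ n) ≡ toℕ w
    val-extend-last = cong toℕ (lookup-extend-last σ w)

    open Extension (val σ) (toℕ w) (val (extend σ w)) val-extend val-extend-last public
    open Step (val σ) (toℕ w) (val (extend σ w)) val-extend val-extend-last (λ i → toℕ<n (lookup σ i)) public using (step)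

  map-injective : ∀ {A B : Set} {f : A → B} → (∀ {x y} → f x ≡ f y → x ≡ y) →
    ∀ {n} {xs ys : Vec A n} → mapᵛ f xs ≡ mapᵛ f ys → xs ≡ ys
  map-injective inj {xs = []ᵛ}     {[]ᵛ}     _  = refl
  map-injective inj {xs = x ∷ᵛ xs} {y ∷ᵛ ys} eq =
    let fx≡fy , fxs≡fys = ∷-injective eq in cong₂ _∷ᵛ_ (inj fx≡fy) (map-injective inj fxs≡fys)

  extend-injective : ∀ {n} {σ τ : Vec (Fin n) n} {v w} → extend σ v ≡ extend τ w → σ ≡ τ × v ≡ w
  extend-injective {σ = σ} {τ} {v} eq with ∷ʳ-injective _ _ eq
  ... | eq′ , refl = map-injective (λ {x} {y} → punchIn-injective v x y) eq′ , refl

  extend-perm : ∀ {n} (σ : Vec (Fin n) n) w → IsPerm σ → IsPerm (extend σ w)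
  extend-perm σ w perm i j eq with view i | view j
  ... | ‵fromℕ     | ‵fromℕ     = refl
  ... | ‵fromℕ     | ‵inject₁ j = contradiction (trans (sym (lookup-extend σ w j)) (trans (sym eq) (lookup-extend-last σ w))) (punchInᵢ≢i w _)
  ... | ‵inject₁ i | ‵fromℕ     = contradiction (trans (sym (lookup-extend σ w i)) (trans eq (lookup-extend-last σ w))) (punchInᵢ≢i w _)
  ... | ‵inject₁ i | ‵inject₁ j = cong inject₁ (perm i j (punchIn-injective w _ _
          (trans (sym (lookup-extend σ w i)) (trans eq (lookup-extend σ w j)))))

  extend-perm⁻ : ∀ {n} (σ : Vec (Fin n) n) w → IsPerm (extend σ w) → IsPerm σ
  extend-perm⁻ σ w perm i j eq = inject₁-injective (perm (inject₁ i) (inject₁ j)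
    (trans (lookup-extend σ w i) (trans (cong (punchIn w) eq) (sym (lookup-extend σ w j)))))

  unextend : ∀ {n} (σ : Vec (Fin (suc n)) (suc n)) → IsPerm σ → ∃ λ τ → ∃ λ w → σ ≡ extend τ w
  unextend {n} σ perm with initLast σ
  ... | ys , w , refl = τ , w , cong (_∷ʳ w) (trans (sym (tabulate∘lookup ys)) (trans (tabulate-cong same) (tabulate∘lookup (mapᵛ (punchIn w) τ))))
    where
    w≢ : ∀ i → w ≢ lookup ys i
    w≢ i eq = fromℕ≢inject₁ (perm (fromℕ n) (inject₁ i)
      (trans (lookup-∷ʳ-fromℕ ys w) (trans eq (sym (lookup-∷ʳ-inject₁ ys w i)))))
    τ : Vec (Fin n) n
    τ = tabulate (λ i → punchOut (w≢ i))
    same : ∀ i → lookup ys i ≡ lookup (mapᵛ (punchIn w) τ) i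
    same i = sym (trans (lookup-map i (punchIn w) τ) (trans (cong (punchIn w) (lookup∘tabulate _ i)) (punchIn-punchOut (w≢ i))))

  sites : ℕ → (m : ℕ) → List (Fin m)
  sites zero    m       = []
  sites (suc k) zero    = []
  sites (suc k) (suc m) = fzero ∷ map fsuc (sites k m)

  ∈-sites⁺ : ∀ k {m} {v : Fin m} → toℕ v < k → v ∈ sites k m
  ∈-sites⁺ (suc k) {suc m} {fzero}  _         = here refl
  ∈-sites⁺ (suc k) {suc m} {fsuc v} (s≤s v<k) = there (∈-map⁺ fsuc (∈-sites⁺ k v<k))

  sites-< : ∀ k m → All (λ v → toℕ v < k) (sites k m)
  sites-< zero    m       = []
  sites-< (suc k) zero    = []
  sites-< (suc k) (suc m) = s≤s z≤n ∷ All.map⁺ (All.map s≤s (sites-< k m))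

  sites-unique : ∀ k m → Unique (sites k m)
  sites-unique zero    m       = []
  sites-unique (suc k) zero    = []
  sites-unique (suc k) (suc m) = All.map⁺ (All.universal (λ _ ()) (sites k m)) ∷ Unique.map⁺ Fin.suc-injective (sites-unique k m)

  Node : ℕ → Set
  Node n = Vec (Fin n) n × State

  expand : ∀ {n} → Node n → List (Node (suc n))
  expand {n} (σ , s) = map (λ v → extend σ v , child s (toℕ v)) (sites (arity s) (suc n))

  level : ∀ n → List (Node n)
  level zero    = ([]ᵛ , root) ∷ []
  level (suc n) = concatMap expand (level n)

  -- Surjectivity is carried along with injectivity because the upper bounds on active and splitting
  -- sites are witnessed by the positions of given values.
  record Good {n} (node : Node n) : Set where
    σ = proj₁ node
    s = proj₂ node
    field
      perm      : IsPerm σ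
      avoiding  : Avoiding (val σ)
      onto      : Onto (val σ)
      invariant : Invariant s (val σ)

  level-good : ∀ n → All Good (level n)
  level-good zero    = record
    { perm = λ () ; avoiding = λ { {()} } ; onto = λ () ; invariant = refl } ∷ []
  level-good (suc n) = All.concat⁺ (All.map⁺ (All.map expand-good (level-good n)))
    where
    expand-good : ∀ {node : Node n} → Good node → All Good (expand node)
    expand-good {σ , s} good = All.map⁺ (All.map site-good (sites-< (arity s) (suc n)))
      where
      open Good good using (perm; avoiding; onto; invariant)
      site-good : ∀ {v : Fin (suc n)} → toℕ v < arity s → Good (extend σ v , child s (toℕ v))
      site-good {v} v<k = record
        { perm      = extend-perm σ v perm
        ; avoiding  = Avoiding⁺ σ v avoiding active
        ; onto      = Onto-ext σ v onto (s≤s⁻¹ (toℕ<n v))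
        ; invariant = step σ v onto s invariant active v<k
        }
        where
        active : Active (val σ) (toℕ v)
        active = from (Active⇔<arity s invariant (s≤s⁻¹ (toℕ<n v))) v<k

  -- Deleting the last value stays in the class and shows that this value was an active site of the
  -- parent; the label of the parent turns this into membership among the expanded sites.
  level-complete : ∀ {n} (σ : Vec (Fin n) n) → IsPerm σ → Avoiding (val σ) → ∃ λ s → (σ , s) ∈ level n
  level-complete {zero}  []ᵛ _ _ = root , here refl
  level-complete {suc n} σ perm av with unextend σ perm
  ... | τ , w , refl = child s (toℕ w) , ∈-concatMap⁺ expand (Any.map (λ { refl → member }) τ∈)
    where
    av⁻ : Avoiding (val τ) × Active (val τ) (toℕ w)
    av⁻ = Avoiding⁻ τ w av
    found : ∃ λ s → (τ , s) ∈ level n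
    found = level-complete τ (extend-perm⁻ τ w perm) (proj₁ av⁻)
    s : State
    s = proj₁ found
    τ∈ : (τ , s) ∈ level n
    τ∈ = proj₂ found
    member : (extend τ w , child s (toℕ w)) ∈ expand (τ , s)
    member = ∈-map⁺ (λ v → extend τ v , child s (toℕ v)) (∈-sites⁺ (arity s)
      (to (Active⇔<arity s (Good.invariant (All.lookup (level-good n) τ∈)) (s≤s⁻¹ (toℕ<n w))) (proj₂ av⁻)))

  -- Distinctness is asked of the permutations alone, since the labels are forgotten when counting.
  level-unique : ∀ n → AllPairs (λ x y → proj₁ x ≢ proj₁ y) (level n)
  level-unique zero    = [] ∷ []
  level-unique (suc n) = AllPairs.concat⁺
    (All.map⁺ (All.universal (λ (σ , s) → AllPairs.map⁺ (AllPairs.map (λ v≢w eq → v≢w (proj₂ (extend-injective eq)))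
                                                       (sites-unique (arity s) (suc n)))) (level n)))
    (AllPairs.map⁺ (AllPairs.map (λ {x} {y} → disjoint x y) (level-unique n)))
    where
    disjoint : ∀ (x y : Node n) → proj₁ x ≢ proj₁ y → All (λ a → All (λ b → proj₁ a ≢ proj₁ b) (expand y)) (expand x)
    disjoint (σ , s) (τ , t) σ≢τ = All.map⁺ (All.universal (λ v → All.map⁺ (All.universal
      (λ w eq → σ≢τ (proj₁ (extend-injective eq))) (sites (arity t) (suc n)))) (sites (arity s) (suc n)))

  total : ℕ → ∀ {n} → List (Node n) → ℕ
  total m []             = 0
  total m ((σ , s) ∷ xs) = descendants m s + total m xs

  total-++ : ∀ m {n} (xs ys : List (Node n)) → total m (xs ++ ys) ≡ total m xs + total m ys
  total-++ m []             ys = refl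
  total-++ m ((σ , s) ∷ xs) ys = trans (cong (_+_ (descendants m s)) (total-++ m xs ys)) (sym (ℕ.+-assoc (descendants m s) _ _))

  total-sites : ∀ m {n p} (τ : Fin n → Vec (Fin p) p) (c : ℕ → State) k → k ≤ n →
    total m (map (λ v → τ v , c (toℕ v)) (sites k n)) ≡ sumTo k (descendants m ∘ c)
  total-sites m τ c zero    _         = refl
  total-sites m {suc n} τ c (suc k) (s≤s k≤n) = cong (_+_ (descendants m (c 0))) (trans
    (cong (total m) (sym (map-∘ (sites k n))))
    (total-sites m (τ ∘ fsuc) (c ∘ suc) k k≤n))

  total-expand : ∀ m {n} (xs : List (Node n)) → All Good xs → total m (concatMap expand xs) ≡ total (suc m) xs
  total-expand m []             []             = refl
  total-expand m ((σ , s) ∷ xs) (good ∷ goods) = trans (total-++ m (expand (σ , s)) (concatMap expand xs))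
    (cong₂ _+_ (total-sites m (extend σ) (child s) (arity s) (arity≤ s (Good.invariant good))) (total-expand m xs goods))

  -- Moving down one level uses up one unit of m. The case m = 0 counts each node of level n once.
  total-level : ∀ n m → total m (level n) ≡ descendants (n + m) root
  total-level zero    m = ℕ.+-identityʳ _
  total-level (suc n) m = trans (total-expand m (level n) (level-good n))
    (trans (total-level n (suc m)) (cong (λ k → descendants k root) (ℕ.+-suc n m)))

  length-total : ∀ {n} (xs : List (Node n)) → length xs ≡ total 0 xs
  length-total []       = refl
  length-total (x ∷ xs) = cong suc (length-total xs)

  HasCard-unique : ∀ {A : Set} {P : A → Set} {c d} → HasCard P c → HasCard P d → c ≡ d
  HasCard-unique (xs , xs! , refl , p) (ys , ys! , refl , q) =
    ↭-length (∼bag⇒↭ (unique∧set⇒bag xs! ys! λ {x} → mk⇔ (from (q x) ∘ to (p x)) (from (p x) ∘ to (q x))))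

  descendants-card : ∀ n → HasCard {Vec (Fin n) n} (λ σ → IsPerm σ × Avoids σ basis) (descendants n root)
  descendants-card n = map proj₁ (level n) , AllPairs.map⁺ (level-unique n) , card , λ σ → mk⇔ sound (complete σ)
    where
    card : length (map proj₁ (level n)) ≡ descendants n root
    card = trans (length-map proj₁ (level n)) (trans (length-total (level n))
      (trans (total-level n 0) (cong (λ k → descendants k root) (ℕ.+-identityʳ n))))
    sound : ∀ {σ} → σ ∈ map proj₁ (level n) → IsPerm σ × Avoids σ basis
    sound σ∈ with ∈-map⁻ proj₁ σ∈
    ... | (σ , s) , node∈ , refl = let good = All.lookup (level-good n) node∈ in
      Good.perm good , Avoiding⇒Avoids σ (Good.avoiding good)
    complete : ∀ σ → IsPerm σ × Avoids σ basis → σ ∈ map proj₁ (level n)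
    complete σ (perm , av) = ∈-map⁺ proj₁ (proj₂ (level-complete σ perm (Avoids⇒Avoiding σ av)))

-- Finite sums, contraction, and sums weighted by powers of z.

module GeneratingFunctions where

  open PowerSeries
  open GeneratingTree
  import Data.Integer as ℤ
  import Data.Integer.Properties as ℤ
  open import Data.Nat as ℕ using (zero; suc)
  import Data.Nat.Properties as ℕ
  open import Data.Product using (_,_)
  open import Function using (_∘_)
  open import Relation.Binary.PropositionalEquality as ≡ using (_≢_; cong; cong₂)
  open import Relation.Nullary using (contradiction)
  open import Relation.Binary.Reasoning.Setoid PSR.setoid
  open PSR using (_+_; _*_; _-_; 0#; 1#; refl; sym; trans; +-cong; +-congˡ; +-congʳ; *-congˡ; *-congʳ)
  open _≋_

  ∑ : ℕ → (ℕ → PS) → PS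
  ∑ zero    F = 0#
  ∑ (suc k) F = F 0 + ∑ k (F ∘ suc)

  ∑-snoc : ∀ k F → ∑ (suc k) F ≋ ∑ k F + F k
  ∑-snoc zero    F = PSR.+-comm (F 0) 0#
  ∑-snoc (suc k) F = trans (+-congˡ (∑-snoc k (F ∘ suc))) (sym (PSR.+-assoc (F 0) _ _))

  -- The combination is that of `defect`, so that the defect of a sum is the sum of the defects.
  ∑-linear : ∀ k a F G H → ∑ k (λ i → F i - G i - a * H i) ≋ ∑ k F - ∑ k G - a * ∑ k H
  ∑-linear zero    a F G H = solve 1 (λ a → con (+ 0) := con (+ 0) :- con (+ 0) :- a :* con (+ 0)) refl a
  ∑-linear (suc k) a F G H = begin
    F 0 - G 0 - a * H 0 + ∑ k (λ i → F (suc i) - G (suc i) - a * H (suc i))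
      ≈⟨ +-congˡ (∑-linear k a (F ∘ suc) (G ∘ suc) (H ∘ suc)) ⟩
    F 0 - G 0 - a * H 0 + (∑ k (F ∘ suc) - ∑ k (G ∘ suc) - a * ∑ k (H ∘ suc))
      ≈⟨ solve 7 (λ a f g h f′ g′ h′ → f :- g :- a :* h :+ (f′ :- g′ :- a :* h′)
                                     := (f :+ f′) :- (g :+ g′) :- a :* (h :+ h′)) refl
           a (F 0) (G 0) (H 0) (∑ k (F ∘ suc)) (∑ k (G ∘ suc)) (∑ k (H ∘ suc)) ⟩
    ∑ (suc k) F - ∑ (suc k) G - a * ∑ (suc k) H ∎

  ∑-piece : ∀ {A : Set} (F : A → PS) l r f g →
            ∑ (l ℕ.+ r) (F ∘ piece l f g) ≋ ∑ l (F ∘ f) + ∑ r (F ∘ g)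
  ∑-piece F zero    r f g = sym (PSR.+-identityˡ _)
  ∑-piece F (suc l) r f g = trans (+-congˡ (∑-piece F l r (f ∘ suc) g)) (sym (PSR.+-assoc (F (f 0)) _ _))

  0#≡0 : ∀ n → 0# n ≡ + 0
  0#≡0 zero    = ≡.refl
  0#≡0 (suc n) = ≡.refl

  opaque
    unfolding _⊞_ _⊠_

    -- The factor z makes coefficient n + 1 of every F i depend only on coefficient n of H i.
    -- Treating all indices at once admits infinite systems.
    contraction : ∀ {I : Set} (F H : I → PS) → (∀ i → F i ≋ z * H i) →
                  (∀ n → (∀ i → F i n ≡ + 0) → ∀ i → H i n ≡ + 0) →
                  ∀ i → F i ≋ 0#
    contraction F H p q i = pointwise λ n → ≡.trans (vanish n i) (≡.sym (0#≡0 n))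
      where
      vanish : ∀ n i → F i n ≡ + 0
      vanish zero    i = ≡.trans (coeff (p i) 0) (z⊛ (H i) 0)
      vanish (suc n) i = ≡.trans (coeff (p i) (suc n)) (≡.trans (z⊛ (H i) (suc n)) (q n (vanish n) i))

  difference-zero : ∀ f g → f - g ≋ 0# → f ≋ g
  difference-zero f g p = begin
    f          ≈⟨ solve 2 (λ f g → f := (f :- g) :+ g) refl f g ⟩
    (f - g) + g ≈⟨ +-congʳ p ⟩
    0# + g     ≈⟨ PSR.+-identityˡ g ⟩
    g ∎

  -- Φ F is the sum of the series z^j F_j.
  Φ : (ℕ → PS) → PS
  Φ F zero    = F 0 0
  Φ F (suc n) = F 0 (suc n) ℤ.+ Φ (F ∘ suc) n

  opaque
    unfolding _⊞_ _⊠_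

    Φ-unfold : ∀ F → Φ F ≋ F 0 + z * Φ (F ∘ suc)
    Φ-unfold F = pointwise λ n → ≡.trans (unfold n) (cong (ℤ._+_ (F 0 n)) (≡.sym (z⊛ (Φ (F ∘ suc)) n)))
      where
      unfold : ∀ n → Φ F n ≡ F 0 n ℤ.+ shift (Φ (F ∘ suc)) n
      unfold zero    = ≡.sym (ℤ.+-identityʳ _)
      unfold (suc n) = ≡.refl

  Φ-cong : ∀ {F G} → (∀ j → F j ≋ G j) → Φ F ≋ Φ G
  Φ-cong p = pointwise (agree p)
    where
    agree : ∀ {F G} → (∀ j → F j ≋ G j) → Φ F ≈ₚ Φ G
    agree p zero    = coeff (p 0) 0
    agree p (suc n) = cong₂ ℤ._+_ (coeff (p 0) (suc n)) (agree (p ∘ suc) n)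

  opaque
    unfolding _⊞_ _⊠_

    -- Iteration leaves a remainder z ^ n Ψ n, which is invisible to every fixed coefficient once n
    -- is large. Weighted sums are evaluated by guessing Ψ.
    Φ-unique : ∀ (F Ψ : ℕ → PS) → (∀ j → Ψ j ≋ F j + z * Ψ (suc j)) → Ψ 0 ≋ Φ F
    Φ-unique F Ψ p = pointwise (agree F Ψ p)
      where
      agree : ∀ (F Ψ : ℕ → PS) → (∀ j → Ψ j ≋ F j + z * Ψ (suc j)) → Ψ 0 ≈ₚ Φ F
      agree F Ψ p zero    = ≡.trans (coeff (p 0) 0) (≡.trans (cong (ℤ._+_ (F 0 0)) (z⊛ (Ψ 1) 0)) (ℤ.+-identityʳ _))
      agree F Ψ p (suc n) = ≡.trans (coeff (p 0) (suc n))
        (cong (ℤ._+_ (F 0 (suc n))) (≡.trans (z⊛ (Ψ 1) (suc n)) (agree (F ∘ suc) (Ψ ∘ suc) (p ∘ suc) n)))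

  drop : ℕ → (ℕ → PS) → ℕ → PS
  drop j F i = F (j ℕ.+ i)

  Φ-step : ∀ F j → Φ (drop j F) ≋ F j + z * Φ (drop (suc j) F)
  Φ-step F j = begin
    Φ (drop j F)                                ≈⟨ Φ-unfold (drop j F) ⟩
    F (j ℕ.+ 0) + z * Φ (λ i → F (j ℕ.+ suc i)) ≈⟨ +-cong (PSR.reflexive (cong F (ℕ.+-identityʳ j)))
                                                    (*-congˡ {z} (Φ-cong (λ i → PSR.reflexive (cong F (ℕ.+-suc j i))))) ⟩
    F j + z * Φ (drop (suc j) F) ∎

  Φ-+ : ∀ F G → Φ (λ j → F j + G j) ≋ Φ F + Φ G
  Φ-+ F G = sym (Φ-unique (λ j → F j + G j) (λ j → Φ (drop j F) + Φ (drop j G)) λ j → begin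
    Φ (drop j F) + Φ (drop j G)
      ≈⟨ +-cong (Φ-step F j) (Φ-step G j) ⟩
    F j + z * Φ (drop (suc j) F) + (G j + z * Φ (drop (suc j) G))
      ≈⟨ solve 5 (λ z f g f′ g′ → f :+ z :* f′ :+ (g :+ z :* g′) := f :+ g :+ z :* (f′ :+ g′)) refl
           z (F j) (G j) (Φ (drop (suc j) F)) (Φ (drop (suc j) G)) ⟩
    F j + G j + z * (Φ (drop (suc j) F) + Φ (drop (suc j) G)) ∎)

  Φ-* : ∀ a F → Φ (λ j → a * F j) ≋ a * Φ F
  Φ-* a F = sym (Φ-unique (λ j → a * F j) (λ j → a * Φ (drop j F)) λ j → begin
    a * Φ (drop j F)
      ≈⟨ *-congˡ {a} (Φ-step F j) ⟩
    a * (F j + z * Φ (drop (suc j) F))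
      ≈⟨ solve 4 (λ z a f f′ → a :* (f :+ z :* f′) := a :* f :+ z :* (a :* f′)) refl z a (F j) (Φ (drop (suc j) F)) ⟩
    a * F j + z * (a * Φ (drop (suc j) F)) ∎)

  -- Generating functions of the labels and the recurrence in l.

  opaque
    gf : State → PS
    gf s n = + descendants n s

    gf-coeff : ∀ s n → gf s n ≡ + descendants n s
    gf-coeff s n = ≡.refl

  opaque
    unfolding _⊞_ _⊠_ gf

    gf-eq : ∀ s → gf s ≋ 1# + z * ∑ (arity s) (gf ∘ child s)
    gf-eq s = pointwise λ n → ≡.sym (≡.trans (cong (ℤ._+_ (1# n)) (z⊛ (∑ (arity s) (gf ∘ child s)) n)) (unfold n))
      where
      cast : ∀ n k c → ∑ k (gf ∘ c) n ≡ + sumTo k (descendants n ∘ c)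
      cast n zero    c = 0#≡0 n
      cast n (suc k) c = cong (ℤ._+_ (+ descendants n (c 0))) (cast n k (c ∘ suc))
      unfold : ∀ n → 1# n ℤ.+ shift (∑ (arity s) (gf ∘ child s)) n ≡ gf s n
      unfold zero    = ≡.refl
      unfold (suc n) = ≡.trans (ℤ.+-identityˡ _) (cast n (arity s) (child s))

  -- The child at site 0 has the largest label; moved to the end, it completes the run D 2, ..., D
  -- (k + 1).
  D-eq : ∀ k → gf (D k) ≋ 1# + z * ∑ k (gf ∘ D₂)
  D-eq zero    = gf-eq (D 0)
  D-eq (suc k) = trans (gf-eq (D (suc k)))
    (+-congˡ (*-congˡ {z} (trans (PSR.+-comm (gf (D (2 ℕ.+ k))) _) (sym (∑-snoc k _)))))

  D₀ : gf (D 0) ≋ 1#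
  D₀ = trans (D-eq 0) (solve 1 (λ z → con (+ 1) :+ z :* con (+ 0) := con (+ 1)) refl z)

  -- This is C = 1 + zC² multiplied by C ^ l, the recurrence of the powers of the Catalan series.
  Ladder : (ℕ → PS) → Set
  Ladder F = ∀ l → F (suc l) ≋ F l + z * F (2 ℕ.+ l)

  D-ladder : Ladder (gf ∘ D)
  D-ladder k = begin
    gf (D (suc k))                                                  ≈⟨ D-eq (suc k) ⟩
    1# + z * ∑ (suc k) (gf ∘ D₂)                     ≈⟨ +-congˡ (*-congˡ {z} (∑-snoc k _)) ⟩
    1# + z * (∑ k (gf ∘ D₂) + gf (D (2 ℕ.+ k)))
      ≈⟨ solve 3 (λ z s d → con (+ 1) :+ z :* (s :+ d) := con (+ 1) :+ z :* s :+ z :* d) refl z (∑ k (gf ∘ D₂)) (gf (D (2 ℕ.+ k))) ⟩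
    1# + z * ∑ k (gf ∘ D₂) + z * gf (D (2 ℕ.+ k))    ≈⟨ +-congʳ (D-eq k) ⟨
    gf (D k) + z * gf (D (2 ℕ.+ k)) ∎

  opaque
    unfolding _⊞_ _⊠_

    -- Although the recurrence has order two, F 0 determines everything: the term F (l + 2)
    -- contributes only an earlier coefficient, so induction is lexicographic in n and l.
    ladder-zero : ∀ F → Ladder F → F 0 ≋ 0# → ∀ l → F l ≋ 0#
    ladder-zero F p F₀ l = pointwise λ n → ≡.trans (vanish n l) (≡.sym (0#≡0 n))
      where
      coefficient : ∀ l n → F (suc l) n ≡ F l n ℤ.+ shift (F (2 ℕ.+ l)) n
      coefficient l n = ≡.trans (coeff (p l) n) (cong (ℤ._+_ (F l n)) (z⊛ (F (2 ℕ.+ l)) n))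
      vanish : ∀ n l → F l n ≡ + 0
      vanish n       zero    = ≡.trans (coeff F₀ n) (0#≡0 n)
      vanish zero    (suc l) = ≡.trans (coefficient l 0) (cong (ℤ._+ + 0) (vanish 0 l))
      vanish (suc n) (suc l) = ≡.trans (coefficient l (suc n)) (cong₂ ℤ._+_ (vanish (suc n) l) (vanish n (2 ℕ.+ l)))

  ladder-factor : ∀ F → Ladder F → ∀ l → F l ≋ gf (D l) * F 0
  ladder-factor F p l = difference-zero _ _ (ladder-zero (λ l → F l - gf (D l) * F 0) ladder bottom l)
    where
    bottom : F 0 - gf (D 0) * F 0 ≋ 0#
    bottom = begin
      F 0 - gf (D 0) * F 0 ≈⟨ +-congˡ (PSR.-‿cong (*-congʳ D₀)) ⟩
      F 0 - 1# * F 0       ≈⟨ solve 1 (λ f → f :- con (+ 1) :* f := con (+ 0)) refl (F 0) ⟩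
      0# ∎
    ladder : Ladder (λ l → F l - gf (D l) * F 0)
    ladder l = begin
      F (suc l) - gf (D (suc l)) * F 0
        ≈⟨ +-cong (p l) (PSR.-‿cong (*-congʳ (D-ladder l))) ⟩
      F l + z * F (2 ℕ.+ l) - (gf (D l) + z * gf (D (2 ℕ.+ l))) * F 0
        ≈⟨ solve 6 (λ z f f′ d d′ x → f :+ z :* f′ :- (d :+ z :* d′) :* x := f :- d :* x :+ z :* (f′ :- d′ :* x)) refl
             z (F l) (F (2 ℕ.+ l)) (gf (D l)) (gf (D (2 ℕ.+ l))) (F 0) ⟩
      F l - gf (D l) * F 0 + z * (F (2 ℕ.+ l) - gf (D (2 ℕ.+ l)) * F 0) ∎

  -- A shifted ladder is again a ladder. This identifies gf (D l) as the l-th power of C.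
  D-shift : ∀ m l → gf (D (l ℕ.+ m)) ≋ gf (D l) * gf (D m)
  D-shift m = ladder-factor (λ l → gf (D (l ℕ.+ m))) (λ l → D-ladder (l ℕ.+ m))

  -- The summands D 2, ..., D (l + 1) are the children of a `D l`, and the constant 1 completes them
  -- to gf (D l).
  absorb-D : ∀ l s → 1# + z * (∑ l (gf ∘ D₂) + s) ≋ gf (D l) + z * s
  absorb-D l s = trans
    (solve 3 (λ z t s → con (+ 1) :+ z :* (t :+ s) := con (+ 1) :+ z :* t :+ z :* s) refl z (∑ l (gf ∘ D₂)) s)
    (+-congʳ (sym (D-eq l)))

  E-eq : ∀ l j → gf (E l j) ≋ gf (D l) + z * (gf (D (4 ℕ.+ (l ℕ.+ j))) + (∑ (suc j) (gf ∘ E l) + gf (E l j)))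
  E-eq l j = begin
    gf (E l j)
      ≈⟨ gf-eq (E l j) ⟩
    1# + z * (d + ∑ (l ℕ.+ (suc j ℕ.+ 1)) (λ v → gf (child (E l j) (suc v))))
      ≈⟨ +-congˡ (*-congˡ {z} (+-congˡ (trans (∑-piece gf l (suc j ℕ.+ 1) D₂ (piece (suc j) (E l) (λ _ → E l j)))
           (+-congˡ (∑-piece gf (suc j) 1 (E l) (λ _ → E l j)))))) ⟩
    1# + z * (d + (∑ l (gf ∘ D₂) + (∑ (suc j) (gf ∘ E l) + (gf (E l j) + 0#))))
      ≈⟨ solve 5 (λ z d t s e → con (+ 1) :+ z :* (d :+ (t :+ (s :+ (e :+ con (+ 0))))) :=
                                con (+ 1) :+ z :* (t :+ (d :+ (s :+ e)))) refl z d (∑ l (gf ∘ D₂)) (∑ (suc j) (gf ∘ E l)) (gf (E l j)) ⟩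
    1# + z * (∑ l (gf ∘ D₂) + (d + (∑ (suc j) (gf ∘ E l) + gf (E l j))))
      ≈⟨ absorb-D l (d + (∑ (suc j) (gf ∘ E l) + gf (E l j))) ⟩
    gf (D l) + z * (d + (∑ (suc j) (gf ∘ E l) + gf (E l j))) ∎
    where d = gf (D (4 ℕ.+ (l ℕ.+ j)))

  U-eq : ∀ l m → gf (U l m) ≋ gf (D l) + z * (gf (U (suc (l ℕ.+ m)) 0) + (∑ m (gf ∘ E l) + gf (U l (suc m))))
  U-eq l m = begin
    gf (U l m)
      ≈⟨ gf-eq (U l m) ⟩
    1# + z * (u + ∑ (l ℕ.+ (m ℕ.+ 1)) (λ v → gf (child (U l m) (suc v))))
      ≈⟨ +-congˡ (*-congˡ {z} (+-congˡ (trans (∑-piece gf l (m ℕ.+ 1) D₂ (piece m (E l) (λ _ → U l (suc m))))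
           (+-congˡ (∑-piece gf m 1 (E l) (λ _ → U l (suc m))))))) ⟩
    1# + z * (u + (∑ l (gf ∘ D₂) + (∑ m (gf ∘ E l) + (gf (U l (suc m)) + 0#))))
      ≈⟨ solve 5 (λ z d t s e → con (+ 1) :+ z :* (d :+ (t :+ (s :+ (e :+ con (+ 0))))) :=
                                con (+ 1) :+ z :* (t :+ (d :+ (s :+ e)))) refl z u (∑ l (gf ∘ D₂)) (∑ m (gf ∘ E l)) (gf (U l (suc m))) ⟩
    1# + z * (∑ l (gf ∘ D₂) + (u + (∑ m (gf ∘ E l) + gf (U l (suc m)))))
      ≈⟨ absorb-D l (u + (∑ m (gf ∘ E l) + gf (U l (suc m)))) ⟩
    gf (D l) + z * (u + (∑ m (gf ∘ E l) + gf (U l (suc m)))) ∎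
    where u = gf (U (suc (l ℕ.+ m)) 0)

  defect : (ℕ → PS) → ℕ → PS
  defect F l = F (suc l) - F l - z * F (2 ℕ.+ l)

  Ladder⇒defect≋0 : ∀ F → Ladder F → ∀ l → defect F l ≋ 0#
  Ladder⇒defect≋0 F p l = begin
    F (suc l) - F l - z * F (2 ℕ.+ l)               ≈⟨ +-congʳ (+-congʳ (p l)) ⟩
    F l + z * F (2 ℕ.+ l) - F l - z * F (2 ℕ.+ l)
      ≈⟨ solve 3 (λ z f g → f :+ z :* g :- f :- z :* g := con (+ 0)) refl z (F l) (F (2 ℕ.+ l)) ⟩
    0# ∎

  defect≋0⇒Ladder : ∀ F → (∀ l → defect F l ≋ 0#) → Ladder F
  defect≋0⇒Ladder F p l = begin
    F (suc l)                               ≈⟨ solve 4 (λ z f₁ f₀ f₂ → f₁ := (f₁ :- f₀ :- z :* f₂) :+ (f₀ :+ z :* f₂)) refl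
                                                 z (F (suc l)) (F l) (F (2 ℕ.+ l)) ⟩
    defect F l + (F l + z * F (2 ℕ.+ l))    ≈⟨ +-congʳ (p l) ⟩
    0# + (F l + z * F (2 ℕ.+ l))            ≈⟨ PSR.+-identityˡ _ ⟩
    F l + z * F (2 ℕ.+ l) ∎

  -- The defect is linear, and gf (D l), itself a ladder, drops out; what remains is homogeneous
  -- with a factor z.
  defect-eq : ∀ (F A B S : ℕ → PS) → (∀ l → F l ≋ gf (D l) + z * (A l + (B l + S l))) →
              ∀ l → defect F l ≋ z * (defect A l + (defect B l + defect S l))
  defect-eq F A B S p l = begin
    F (suc l) - F l - z * F (2 ℕ.+ l)
      ≈⟨ +-cong (+-cong (p (suc l)) (PSR.-‿cong (p l))) (PSR.-‿cong (*-congˡ {z} (p (2 ℕ.+ l)))) ⟩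
    rhs (gf (D (suc l))) (suc l) - rhs (gf (D l)) l - z * rhs (gf (D (2 ℕ.+ l))) (2 ℕ.+ l)
      ≈⟨ +-congʳ (+-congʳ (+-congʳ (D-ladder l))) ⟩
    rhs (gf (D l) + z * gf (D (2 ℕ.+ l))) (suc l) - rhs (gf (D l)) l - z * rhs (gf (D (2 ℕ.+ l))) (2 ℕ.+ l)
      ≈⟨ solve 12 (λ z d₀ d₂ a₀ a₁ a₂ b₀ b₁ b₂ s₀ s₁ s₂ →
             (d₀ :+ z :* d₂ :+ z :* (a₁ :+ (b₁ :+ s₁))) :- (d₀ :+ z :* (a₀ :+ (b₀ :+ s₀)))
               :- z :* (d₂ :+ z :* (a₂ :+ (b₂ :+ s₂)))
             := z :* ((a₁ :- a₀ :- z :* a₂) :+ ((b₁ :- b₀ :- z :* b₂) :+ (s₁ :- s₀ :- z :* s₂)))) refl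
           z (gf (D l)) (gf (D (2 ℕ.+ l))) (A l) (A (suc l)) (A (2 ℕ.+ l))
           (B l) (B (suc l)) (B (2 ℕ.+ l)) (S l) (S (suc l)) (S (2 ℕ.+ l)) ⟩
    z * (defect A l + (defect B l + defect S l)) ∎
    where
    rhs : PS → ℕ → PS
    rhs d l = d + z * (A l + (B l + S l))

  opaque
    unfolding _⊞_

    +-vanish : ∀ {f g} n → f n ≡ + 0 → g n ≡ + 0 → (f + g) n ≡ + 0
    +-vanish n p q = cong₂ ℤ._+_ p q

  ∑-vanish : ∀ k {F : ℕ → PS} n → (∀ i → F i n ≡ + 0) → ∑ k F n ≡ + 0
  ∑-vanish zero    n p = 0#≡0 n
  ∑-vanish (suc k) n p = +-vanish n (p 0) (∑-vanish k n (p ∘ suc))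

  vanish-resp : ∀ {f g} n → f ≋ g → g n ≡ + 0 → f n ≡ + 0
  vanish-resp n p q = ≡.trans (coeff p n) q

  -- The equation for j involves all smaller indices and itself, so the defects for all l and j are
  -- shown to vanish together.
  E-ladder : ∀ j → Ladder (λ l → gf (E l j))
  E-ladder j = defect≋0⇒Ladder _ λ l → contraction Δ Δ-rest
    (λ (l , j) → defect-eq (λ l → gf (E l j)) (A j) (λ l → ∑ (suc j) (gf ∘ E l)) (λ l → gf (E l j)) (λ l → E-eq l j) l)
    (λ n p (l , j) → +-vanish n
      (vanish-resp n (Ladder⇒defect≋0 (A j) (λ l → D-ladder (4 ℕ.+ (l ℕ.+ j))) l) (0#≡0 n))
      (+-vanish n (vanish-resp n (sym (∑-linear (suc j) z (gf ∘ E (suc l)) (gf ∘ E l) (gf ∘ E (2 ℕ.+ l))))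
                                  (∑-vanish (suc j) {λ i → Δ (l , i)} n (λ i → p (l , i))))
                  (p (l , j))))
    (l , j)
    where
    A : ℕ → ℕ → PS
    A j l = gf (D (4 ℕ.+ (l ℕ.+ j)))
    Δ Δ-rest : ℕ × ℕ → PS
    Δ      (l , j) = defect (λ l → gf (E l j)) l
    Δ-rest (l , j) = defect (A j) l + (defect (λ l → ∑ (suc j) (gf ∘ E l)) l + defect (λ l → gf (E l j)) l)

  U-ladder : ∀ m → Ladder (λ l → gf (U l m))
  U-ladder m = defect≋0⇒Ladder _ λ l → contraction Δ Δ-rest
    (λ (l , m) → defect-eq (λ l → gf (U l m)) (A m) (λ l → ∑ m (gf ∘ E l)) (λ l → gf (U l (suc m))) (λ l → U-eq l m) l)
    -- The first label of `U (suc (l + m)) 0` moves along with l, so this defect belongs to the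
    -- family m = 0, at suc (l + m).
    (λ n p (l , m) → +-vanish n (p (suc (l ℕ.+ m) , 0))
      (+-vanish n (vanish-resp n (sym (∑-linear m z (gf ∘ E (suc l)) (gf ∘ E l) (gf ∘ E (2 ℕ.+ l))))
                                  (∑-vanish m {λ i → defect (λ l → gf (E l i)) l} n
                                    (λ i → vanish-resp n (Ladder⇒defect≋0 (λ l → gf (E l i)) (E-ladder i) l) (0#≡0 n))))
                  (p (l , suc m))))
    (l , m)
    where
    A : ℕ → ℕ → PS
    A m l = gf (U (suc (l ℕ.+ m)) 0)
    Δ Δ-rest : ℕ × ℕ → PS
    Δ      (l , m) = defect (λ l → gf (U l m)) l
    Δ-rest (l , m) = defect (A m) l + (defect (λ l → ∑ m (gf ∘ E l)) l + defect (λ l → gf (U l (suc m))) l)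

  -- The Catalan series and the linear equations for Γ, Π and X.

  C : PS
  C = gf (D 1)

  C-eq : C ≋ 1# + z * (C * C)
  C-eq = trans (D-ladder 0) (+-cong D₀ (*-congˡ {z} (D-shift 1 1)))

  D-suc : ∀ j → gf (D (suc j)) ≋ C * gf (D j)
  D-suc j = D-shift j 1

  -- The geometric series with ratio zC has sum C, since C (1 - zC) = 1.
  Φ-D : Φ (gf ∘ D) ≋ C
  Φ-D = sym (begin
    C             ≈⟨ PSR.*-identityˡ C ⟨
    1# * C        ≈⟨ *-congʳ D₀ ⟨
    gf (D 0) * C  ≈⟨ Φ-unique (gf ∘ D) (λ j → gf (D j) * C) unfold ⟩
    Φ (gf ∘ D) ∎)
    where
    unfold : ∀ j → gf (D j) * C ≋ gf (D j) + z * (gf (D (suc j)) * C)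
    unfold j = begin
      gf (D j) * C                        ≈⟨ *-congˡ {gf (D j)} C-eq ⟩
      gf (D j) * (1# + z * (C * C))       ≈⟨ solve 3 (λ z c d → d :* (con (+ 1) :+ z :* (c :* c)) := d :+ z :* ((c :* d) :* c)) refl z C (gf (D j)) ⟩
      gf (D j) + z * ((C * gf (D j)) * C) ≈⟨ +-congˡ (*-congˡ {z} (*-congʳ (D-suc j))) ⟨
      gf (D j) + z * (gf (D (suc j)) * C) ∎

  O Γ Π X B : PS
  O = Φ (λ _ → 1#)
  Γ = Φ (λ j → gf (E 0 j))
  Π = Φ (λ j → ∑ (suc j) (gf ∘ E 0))
  X = gf (U 0 0)
  B = gf root

  O-eq : O ≋ 1# + z * O
  O-eq = Φ-unfold (λ _ → 1#)

  Φ-∑ : Φ (λ j → ∑ j (gf ∘ E 0)) ≋ z * Π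
  Φ-∑ = trans (Φ-unfold (λ j → ∑ j (gf ∘ E 0))) (PSR.+-identityˡ (z * Π))

  Π-eq : Π ≋ z * Π + Γ
  Π-eq = begin
    Π                                                     ≈⟨ Φ-cong (λ j → ∑-snoc j (gf ∘ E 0)) ⟩
    Φ (λ j → ∑ j (gf ∘ E 0) + gf (E 0 j))                 ≈⟨ Φ-+ (λ j → ∑ j (gf ∘ E 0)) (λ j → gf (E 0 j)) ⟩
    Φ (λ j → ∑ j (gf ∘ E 0)) + Γ                          ≈⟨ +-congʳ Φ-∑ ⟩
    z * Π + Γ ∎

  D₄ : gf (D 4) ≋ C * C * (C * C)
  D₄ = trans (D-shift 2 2) (PSR.*-cong (D-shift 1 1) (D-shift 1 1))

  Γ-eq : Γ ≋ O + z * (C * C * (C * C) * C + (Π + Γ))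
  Γ-eq = begin
    Γ
      ≈⟨ Φ-cong (λ j → trans (E-eq 0 j) (+-cong D₀ (*-congˡ {z} (+-congʳ (D-shift j 4))))) ⟩
    Φ (λ j → 1# + z * (gf (D 4) * gf (D j) + (∑ (suc j) (gf ∘ E 0) + gf (E 0 j))))
      ≈⟨ Φ-+ (λ _ → 1#) (λ j → z * (gf (D 4) * gf (D j) + (∑ (suc j) (gf ∘ E 0) + gf (E 0 j)))) ⟩
    O + Φ (λ j → z * (gf (D 4) * gf (D j) + (∑ (suc j) (gf ∘ E 0) + gf (E 0 j))))
      ≈⟨ +-congˡ (Φ-* z (λ j → gf (D 4) * gf (D j) + (∑ (suc j) (gf ∘ E 0) + gf (E 0 j)))) ⟩
    O + z * Φ (λ j → gf (D 4) * gf (D j) + (∑ (suc j) (gf ∘ E 0) + gf (E 0 j)))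
      ≈⟨ +-congˡ (*-congˡ {z} (Φ-+ (λ j → gf (D 4) * gf (D j)) (λ j → ∑ (suc j) (gf ∘ E 0) + gf (E 0 j)))) ⟩
    O + z * (Φ (λ j → gf (D 4) * gf (D j)) + Φ (λ j → ∑ (suc j) (gf ∘ E 0) + gf (E 0 j)))
      ≈⟨ +-congˡ (*-congˡ {z} (+-cong (Φ-* (gf (D 4)) (gf ∘ D)) (Φ-+ (λ j → ∑ (suc j) (gf ∘ E 0)) (λ j → gf (E 0 j))))) ⟩
    O + z * (gf (D 4) * Φ (gf ∘ D) + (Π + Γ))
      ≈⟨ +-congˡ (*-congˡ {z} (+-congʳ (PSR.*-cong D₄ Φ-D))) ⟩
    O + z * (C * C * (C * C) * C + (Π + Γ)) ∎

  -- `U 0 m` has the child `U 0 (suc m)`; unrolling this chain makes X a weighted sum over m. The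
  -- child `U (suc m) 0` contributes C ^ (m + 1) X, and z Π replaces Π because the sum of the
  -- `E 0 i` runs over i < m only.
  X-eq : X ≋ O + z * (X * C * C + z * Π)
  X-eq = begin
    X
      ≈⟨ Φ-unique (λ m → 1# + z * (X * C * gf (D m) + ∑ m (gf ∘ E 0))) (λ m → gf (U 0 m)) unfold ⟩
    Φ (λ m → 1# + z * (X * C * gf (D m) + ∑ m (gf ∘ E 0)))
      ≈⟨ Φ-+ (λ _ → 1#) (λ m → z * (X * C * gf (D m) + ∑ m (gf ∘ E 0))) ⟩
    O + Φ (λ m → z * (X * C * gf (D m) + ∑ m (gf ∘ E 0)))
      ≈⟨ +-congˡ (Φ-* z (λ m → X * C * gf (D m) + ∑ m (gf ∘ E 0))) ⟩
    O + z * Φ (λ m → X * C * gf (D m) + ∑ m (gf ∘ E 0))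
      ≈⟨ +-congˡ (*-congˡ {z} (Φ-+ (λ m → X * C * gf (D m)) (λ m → ∑ m (gf ∘ E 0)))) ⟩
    O + z * (Φ (λ m → X * C * gf (D m)) + Φ (λ m → ∑ m (gf ∘ E 0)))
      ≈⟨ +-congˡ (*-congˡ {z} (+-cong (trans (Φ-* (X * C) (gf ∘ D)) (*-congˡ {X * C} Φ-D)) Φ-∑)) ⟩
    O + z * (X * C * C + z * Π) ∎
    where
    unfold : ∀ m → gf (U 0 m) ≋ 1# + z * (X * C * gf (D m) + ∑ m (gf ∘ E 0)) + z * gf (U 0 (suc m))
    unfold m = begin
      gf (U 0 m)
        ≈⟨ U-eq 0 m ⟩
      gf (D 0) + z * (gf (U (suc m) 0) + (∑ m (gf ∘ E 0) + gf (U 0 (suc m))))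
        ≈⟨ +-cong D₀ (*-congˡ {z} (+-congʳ (trans (ladder-factor (λ l → gf (U l 0)) (U-ladder 0) (suc m)) (*-congʳ (D-suc m))))) ⟩
      1# + z * (C * gf (D m) * X + (∑ m (gf ∘ E 0) + gf (U 0 (suc m))))
        ≈⟨ solve 6 (λ z c d x s u → con (+ 1) :+ z :* (c :* d :* x :+ (s :+ u))
                                 := con (+ 1) :+ z :* (x :* c :* d :+ s) :+ z :* u) refl
             z C (gf (D m)) X (∑ m (gf ∘ E 0)) (gf (U 0 (suc m))) ⟩
      1# + z * (X * C * gf (D m) + ∑ m (gf ∘ E 0)) + z * gf (U 0 (suc m)) ∎

  B-eq : B ≋ 1# + z * X
  B-eq = trans (gf-eq root) (+-congˡ (*-congˡ {z} (PSR.+-identityʳ X)))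

  -- Elimination and the closed form.

  -- Uses an equation with the cofactor k. Nested applications reduce a claim to one ring identity,
  -- a linear combination of the equations.
  absorb : ∀ {f g a b} k → a ≋ b → f ≋ g + k * (a - b) → f ≋ g
  absorb {f} {g} {a} {b} k a≋b p = begin
    f               ≈⟨ p ⟩
    g + k * (a - b) ≈⟨ +-congˡ (*-congˡ {k} (+-congʳ a≋b)) ⟩
    g + k * (b - b) ≈⟨ solve 3 (λ g k b → g :+ k :* (b :- b) := g) refl g k b ⟩
    g ∎

  -- This is (1 - z)² - z: `Γ-eq` is multiplied by 1 - z, which turns z Π into z Γ.
  kernel : PS
  kernel = 1# - const (+ 3) * z + z * z

  C⁵ : PS
  C⁵ = C * C * (C * C) * C

  Γ-solved : kernel * Γ ≋ 1# + (1# - z) * (z * C⁵)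
  Γ-solved = absorb (1# - z) Γ-eq (absorb 1# O-eq (absorb z Π-eq
    (solve 5 (λ z c⁵ o γ π →
      (con (+ 1) :- con (+ 3) :* z :+ z :* z) :* γ
      := con (+ 1) :+ (con (+ 1) :- z) :* (z :* c⁵)
         :+ (con (+ 1) :- z) :* (γ :- (o :+ z :* (c⁵ :+ (π :+ γ))))
         :+ con (+ 1) :* (o :- (con (+ 1) :+ z :* o))
         :+ z :* (π :- (z :* π :+ γ)))
      refl z C⁵ O Γ Π)))

  -- By `C-eq`, the factor 1 - zC² equals C (1 - 2zC), which is how the square root enters the
  -- denominator.
  X-solved : (1# - z) * (1# - z * (C * C)) * X ≋ 1# + z * z * Γ
  X-solved = absorb (1# - z) X-eq (absorb 1# O-eq (absorb (z * z) Π-eq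
    (solve 6 (λ z c x o γ π →
      (con (+ 1) :- z) :* (con (+ 1) :- z :* (c :* c)) :* x
      := con (+ 1) :+ z :* z :* γ
         :+ (con (+ 1) :- z) :* (x :- (o :+ z :* (x :* c :* c :+ z :* π)))
         :+ con (+ 1) :* (o :- (con (+ 1) :+ z :* o))
         :+ z :* z :* (π :- (z :* π :+ γ)))
      refl z C X O Γ Π)))

  T : PS
  T = 1# - const (+ 2) * (z * C)

  -- Division is avoided by keeping on both sides the coefficient of X from `X-solved`; its factors
  -- have constant term 1 and are cancelled in `B-closed`. The cofactors remove B, X and Γ in turn
  -- and then apply `C-eq`.
  B-scaled : (1# - z) * ((1# - z * (C * C)) * (B * T * kernel))
           ≋ (1# - z) * ((1# - z * (C * C)) * ((1# - const (+ 3) * z) * (1# - z * C)))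
  B-scaled = absorb ((1# - z) * (1# - z * (C * C)) * T * kernel) B-eq
    (absorb (z * T * kernel) X-solved (absorb (z * z * z * T) Γ-solved (absorb κ C-eq
    (solve 5 (λ z c b x γ →
      let 1′ = con (+ 1) ; q = 1′ :- con (+ 3) :* z :+ z :* z ; t = 1′ :- con (+ 2) :* (z :* c) ; m = 1′ :- z :* (c :* c)
          c⁵ = c :* c :* (c :* c) :* c in
      (1′ :- z) :* (m :* (b :* t :* q))
      := (1′ :- z) :* (m :* ((1′ :- con (+ 3) :* z) :* (1′ :- z :* c)))
         :+ (1′ :- z) :* m :* t :* q :* (b :- (1′ :+ z :* x))
         :+ z :* t :* q :* ((1′ :- z) :* m :* x :- (1′ :+ z :* z :* γ))
         :+ z :* z :* z :* t :* (q :* γ :- (1′ :+ (1′ :- z) :* (z :* c⁵)))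
         :+ (z :* (z :* (con (+ 2) :+ c :* c) :- 1′
                   :- z :* z :* (1′ :+ con (+ 2) :* c :+ con (+ 3) :* c :* c :- c :* c :* c)
                   :+ z :* z :* z :* (con (+ 2) :* c :+ con (+ 2) :* c :* c :- c :* c :* c :+ con (+ 2) :* c :* c :* c :* c)
                   :- z :* z :* z :* z :* (con (+ 2) :* c :* c :* c :* c))) :* (c :- (1′ :+ z :* (c :* c))))
      refl z C B X Γ))))
    where
    -- The quotient of the identity in z and C left after eliminating B, X and Γ by C − 1 − zC².
    κ : PS
    κ = z * (z * (const (+ 2) + C * C) - const (+ 1)
             - z * z * (const (+ 1) + const (+ 2) * C + const (+ 3) * C * C - C * C * C)
             + z * z * z * (const (+ 2) * C + const (+ 2) * C * C - C * C * C + const (+ 2) * C * C * C * C)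
             - z * z * z * z * (const (+ 2) * C * C * C * C))

  opaque
    unfolding _⊞_ _⊠_ ⊟_

    head-1-z : ∀ f → (1# - z * f) 0 ≡ + 1
    head-1-z f = cong (λ x → + 1 ℤ.+ ℤ.- x) (ℤ.*-zeroˡ (f 0))

    head-+ : ∀ f g → (f + g) 0 ≡ f 0 ℤ.+ g 0
    head-+ f g = ≡.refl

    ⊛≋* : ∀ f g → f ⊛ g ≋ f * g
    ⊛≋* f g = refl

    ⊕≋+ : ∀ f g → f ⊕ g ≋ f + g
    ⊕≋+ f g = refl

    poly-∷≋ : ∀ a as → poly (a ∷ as) ≋ const a + z * poly as
    poly-∷≋ a as = pointwise (poly-∷ a as)

  1-z*-cancel : ∀ f {g h} → (1# - z * f) * g ≋ (1# - z * f) * h → g ≋ h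
  1-z*-cancel f = ⊠-cancelˡ (1# - z * f) _ _ λ eq → contradiction (≡.trans (≡.sym (head-1-z f)) eq) λ ()

  B-closed : B * T * kernel ≋ (1# - const (+ 3) * z) * (1# - z * C)
  B-closed = 1-z*-cancel (C * C) (1-z*-cancel 1# (trans (*-congʳ 1-z1) (trans B-scaled (*-congʳ (sym 1-z1)))))
    where
    1-z1 : 1# - z * 1# ≋ 1# - z
    1-z1 = solve 1 (λ z → con (+ 1) :- z :* con (+ 1) := con (+ 1) :- z) refl z

  poly₂ : ∀ a b → poly (a ∷ b ∷ []) ≋ const a + z * const b
  poly₂ a b = poly-∷≋ a (b ∷ [])

  poly₃ : ∀ a b c → poly (a ∷ b ∷ c ∷ []) ≋ const a + z * (const b + z * const c)
  poly₃ a b c = trans (poly-∷≋ a (b ∷ c ∷ [])) (+-congˡ (*-congˡ {z} (poly₂ b c)))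

  T-squared : T * T ≋ const (+ 1) + z * const -[1+ 3 ]
  T-squared = absorb (const -[1+ 3 ] * z) C-eq
    (solve 2 (λ z c → let t = con (+ 1) :- con (+ 2) :* (z :* c) in
      t :* t := con (+ 1) :+ z :* con -[1+ 3 ] :+ con -[1+ 3 ] :* z :* (c :- (con (+ 1) :+ z :* (c :* c)))) refl z C)

  -- The constant terms make S + T begin with 2, so it can be cancelled from (S + T)(S - T) = 0.
  √-unique : ∀ S → S 0 ≡ + 1 → S * S ≋ T * T → S ≋ T
  √-unique S S₀ p = difference-zero S T (⊠-cancel-zero (S + T) (S - T) S+T₀ (begin
    (S + T) * (S - T) ≈⟨ solve 2 (λ s t → (s :+ t) :* (s :- t) := s :* s :- t :* t) refl S T ⟩
    S * S - T * T     ≈⟨ +-congʳ p ⟩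
    T * T - T * T     ≈⟨ PSR.-‿inverseʳ (T * T) ⟩
    0# ∎))
    where
    T≋ : T ≋ 1# - z * (const (+ 2) * C)
    T≋ = solve 2 (λ z c → con (+ 1) :- con (+ 2) :* (z :* c) := con (+ 1) :- z :* (con (+ 2) :* c)) refl z C
    T₀ : T 0 ≡ + 1
    T₀ = ≡.trans (coeff T≋ 0) (head-1-z (const (+ 2) * C))
    S+T₀ : (S + T) 0 ≢ + 0
    S+T₀ eq = contradiction (≡.trans (≡.sym (≡.trans (head-+ S T) (cong₂ ℤ._+_ S₀ T₀))) eq) λ ()

  gf-root-closed : ∀ S → S 0 ≡ + 1 → (S ⊛ S) ≈ₚ poly (+ 1 ∷ -[1+ 3 ] ∷ []) →
    (gf root ⊛ ((poly (+ 2 ∷ []) ⊛ S) ⊛ poly (+ 1 ∷ -[1+ 2 ] ∷ + 1 ∷ [])))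
      ≋ (poly (+ 1 ∷ -[1+ 2 ] ∷ []) ⊛ (poly (+ 1 ∷ []) ⊕ S))
  gf-root-closed S S₀ S² = begin
    B ⊛ ((const (+ 2) ⊛ S) ⊛ poly (+ 1 ∷ -[1+ 2 ] ∷ + 1 ∷ []))
      ≈⟨ trans (⊛≋* B _) (*-congˡ {B} (trans (⊛≋* (const (+ 2) ⊛ S) _) (*-congʳ (⊛≋* (const (+ 2)) S)))) ⟩
    B * (const (+ 2) * S * poly (+ 1 ∷ -[1+ 2 ] ∷ + 1 ∷ []))
      ≈⟨ *-congˡ {B} (PSR.*-cong (*-congˡ {const (+ 2)} S≋T) (poly₃ (+ 1) -[1+ 2 ] (+ 1))) ⟩
    B * (const (+ 2) * T * (const (+ 1) + z * (const -[1+ 2 ] + z * const (+ 1))))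
      ≈⟨ solve 3 (λ z b t → b :* (con (+ 2) :* t :* (con (+ 1) :+ z :* (con -[1+ 2 ] :+ z :* con (+ 1))))
                         := con (+ 2) :* (b :* t :* (con (+ 1) :- con (+ 3) :* z :+ z :* z))) refl z B T ⟩
    const (+ 2) * (B * T * kernel)
      ≈⟨ *-congˡ {const (+ 2)} B-closed ⟩
    const (+ 2) * ((1# - const (+ 3) * z) * (1# - z * C))
      ≈⟨ solve 2 (λ z c → con (+ 2) :* ((con (+ 1) :- con (+ 3) :* z) :* (con (+ 1) :- z :* c))
                       := (con (+ 1) :+ z :* con -[1+ 2 ]) :* (con (+ 1) :+ (con (+ 1) :- con (+ 2) :* (z :* c)))) refl z C ⟩
    (const (+ 1) + z * const -[1+ 2 ]) * (const (+ 1) + T)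
      ≈⟨ PSR.*-cong (poly₂ (+ 1) -[1+ 2 ]) (+-congˡ S≋T) ⟨
    poly (+ 1 ∷ -[1+ 2 ] ∷ []) * (const (+ 1) + S)
      ≈⟨ trans (⊛≋* (poly (+ 1 ∷ -[1+ 2 ] ∷ [])) _) (*-congˡ {poly (+ 1 ∷ -[1+ 2 ] ∷ [])} (⊕≋+ (const (+ 1)) S)) ⟨
    poly (+ 1 ∷ -[1+ 2 ] ∷ []) ⊛ (const (+ 1) ⊕ S) ∎
    where
    S≋T : S ≋ T
    S≋T = √-unique S S₀ (begin
      S * S                            ≈⟨ ⊛≋* S S ⟨
      S ⊛ S                            ≈⟨ pointwise S² ⟩
      poly (+ 1 ∷ -[1+ 3 ] ∷ [])       ≈⟨ poly₂ (+ 1) -[1+ 3 ] ⟩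
      const (+ 1) + z * const -[1+ 3 ] ≈⟨ T-squared ⟨
      T * T ∎)

  generating-function : (b : ℕ → ℕ) → (∀ n → b n ≡ descendants n root) →
    ∀ S → S 0 ≡ + 1 → (S ⊛ S) ≈ₚ poly (+ 1 ∷ -[1+ 3 ] ∷ []) →
    ((λ n → + b n) ⊛ ((poly (+ 2 ∷ []) ⊛ S) ⊛ poly (+ 1 ∷ -[1+ 2 ] ∷ + 1 ∷ [])))
      ≈ₚ (poly (+ 1 ∷ -[1+ 2 ] ∷ []) ⊛ (poly (+ 1 ∷ []) ⊕ S))
  generating-function b p S S₀ S² n = ≡.trans
    (⊛-cong {λ n → + b n} {gf root} {Q} {Q} (λ n → ≡.trans (cong +_ (p n)) (≡.sym (gf-coeff root n))) (λ _ → ≡.refl) n)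
    (coeff (gf-root-closed S S₀ S²) n)
    where
    Q : PS
    Q = (poly (+ 2 ∷ []) ⊛ S) ⊛ poly (+ 1 ∷ -[1+ 2 ] ∷ + 1 ∷ [])

theorem2p4 : (b : ℕ → ℕ)
  → (∀ n → HasCard {Vec (Fin n) n} (λ σ → IsPerm σ × Avoids σ basis) (b n))
  → (S : PS)
  → S 0 ≡ + 1
  → (S ⊛ S) ≈ₚ poly (+ 1 ∷ -[1+ 3 ] ∷ [])
  → ((λ n → + b n) ⊛ ((poly (+ 2 ∷ []) ⊛ S) ⊛ poly (+ 1 ∷ -[1+ 2 ] ∷ + 1 ∷ [])))
      ≈ₚ (poly (+ 1 ∷ -[1+ 2 ] ∷ []) ⊛ (poly (+ 1 ∷ []) ⊕ S))
theorem2p4 b card = GeneratingFunctions.generating-function b λ n →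
  Enumeration.HasCard-unique (card n) (Enumeration.descendants-card n)
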